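{- Let $P_1,\dots,P_N\in\mathbb{R}^2$ be fixed regular points and let $T_0$ be a full Steiner topology on them. Let $S$ and $S'$ be two adjacent Steiner points of $T_0$, where the neighbors of $S$ are $\{A,B,S'\}$ and the neighbors of $S'$ are $\{C,D,S\}$ (each of $A,B,C,D$ may be a regular or a Steiner point). Let $T_1$ and $T_2$ be the two other topologies obtained from $T_0$ by reorganizing the neighborhood of $S,S'$: in $T_1$ the neighbors of $S$ are $\{B,C,S'\}$ and those of $S'$ are $\{A,D,S\}$; in $T_2$ the neighbors of $S$ are $\{A,C,S'\}$ and those of $S'$ are $\{B,D,S\}$; all other adjacencies are unchanged. Consider a minimal tree for $T_0$, i.e. a placement of the Steiner points minimizing the total Euclidean edge length among all placements realizing $T_0$ (coincident points allowed), and suppose that in this minimal tree the segments $[AB]$ and $[CD]$ intersect. Then: (1) $S$ and $S'$ have the same coordinates; (2) the length $L_{T_0}$ of the minimal tree for $T_0$ satisfies $L_{T_0}\ge L_{T_i}$ for $i=1,2$, where $L_{T_i}$ is the minimal length of a tree with topology $T_i$; (3) in this minimal tree, $|AS|+|BS|+|CS'|+|DS'|+|SS'| = |AB|+|CD|$.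
   Context: A Steiner tree on $N$ given (regular) points is a tree in the plane whose vertex set consists of the regular points together with additional vertices called Steiner points, each Steiner point having degree exactly 3; its length is the sum of the Euclidean lengths of its edges. The topology of a Steiner tree is its combinatorial structure (which vertices are adjacent). A full topology is one with the maximal number $N-2$ of Steiner points. For a fixed topology, the regular points are fixed and the Steiner point positions are variables in $\mathbb{R}^2$; positions may coincide with each other or with regular points (degenerate trees, with zero-length edges). -}

module Defs where

open import Data.Bool.Base using (T; true; false; if_then_else_)
open import Data.Fin.Base using (Fin; zero; suc; inject₁; fromℕ; splitAt; _↑ʳ_)
import Data.Fin.Properties as Fin
open import Data.Integer.Base as ℤ using (+_; -[1+_]; +≤+; +<+)
import Data.Integer.Properties as ℤ
open import Data.List.Base using (length; filter; allFin)
open import Data.Nat.Base as ℕ using (ℕ; zero; suc; z≤n; s≤s; _∸_)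
open import Data.Nat.Coprimality using (Coprime)
import Data.Nat.Properties as ℕ
import Data.Nat.Solver as ℕ-Solver
open import Data.Product.Base using (_×_; _,_; ∃-syntax; proj₁; proj₂)
open import Data.Rational.Base as ℚ using (ℚ; mkℚ; 0ℚ; 1ℚ; ½; ∣_∣; ↥_; ↧ₙ_; *<*)
import Data.Rational.Properties as ℚ
import Data.Rational.Solver as ℚ-Solver
import Data.Rational.Unnormalised.Base as ℚᵘ
import Data.Rational.Unnormalised.Properties as ℚᵘ
open import Data.Sum.Base using (_⊎_; [_,_]′)
open import Data.Vec.Functional using (Vector; foldr)
open import Function.Bundles using (_⇔_)
open import Function.Definitions using (Injective)
open import Level using (0ℓ)
open import Relation.Binary.Core using (Rel)
open import Relation.Binary.Construct.Closure.ReflexiveTransitive using (Star)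
open import Relation.Binary.Definitions using (Decidable; Symmetric; Irreflexive)
open import Relation.Binary.PropositionalEquality
open import Relation.Nullary.Decidable using (does; _×-dec_)
open import Relation.Nullary.Negation using (¬_)

------------------------------------------------------------------------
-- Real numbers: Cauchy sequences of rationals, compared by the setoid
-- equality _≈_ ("the difference tends to 0").

IsCauchy : (ℕ → ℚ) → Set
IsCauchy s = ∀ ε → 0ℚ ℚ.< ε →
  ∃[ K ] ∀ m n → K ℕ.≤ m → K ℕ.≤ n → ∣ s m ℚ.- s n ∣ ℚ.≤ ε

record ℝ : Set where
  constructor mkℝ
  field
    seq    : ℕ → ℚ
    cauchy : IsCauchy seq

open ℝ public

infix 4 _≈_ _≤_

_≈_ : Rel ℝ 0ℓ
x ≈ y = ∀ ε → 0ℚ ℚ.< ε → ∃[ K ] ∀ n → K ℕ.≤ n → ∣ seq x n ℚ.- seq y n ∣ ℚ.≤ ε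

_≤_ : Rel ℝ 0ℓ
x ≤ y = ∀ ε → 0ℚ ℚ.< ε → ∃[ K ] ∀ n → K ℕ.≤ n → seq x n ℚ.≤ seq y n ℚ.+ ε

module Identities where
  open ℚ-Solver.+-*-Solver

  split-diff : ∀ p q → p ≡ q ℚ.+ (p ℚ.- q)
  split-diff = solve 2 (λ p q → p := q :+ (p :- q)) refl

  cancel : ∀ r e → (r ℚ.+ e) ℚ.- r ≡ e
  cancel = solve 2 (λ r e → (r :+ e) :- r := e) refl

  neg-diff : ∀ p r → ℚ.- (p ℚ.- r) ≡ r ℚ.- p
  neg-diff = solve 2 (λ p r → :- (p :- r) := r :- p) refl

  diff-neg : ∀ a b → ℚ.- (a ℚ.- b) ≡ (ℚ.- a) ℚ.- (ℚ.- b)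
  diff-neg = solve 2 (λ a b → :- (a :- b) := (:- a) :- (:- b)) refl

  diff-+ : ∀ a b c d → (a ℚ.+ b) ℚ.- (c ℚ.+ d) ≡ (a ℚ.- c) ℚ.+ (b ℚ.- d)
  diff-+ = solve 4 (λ a b c d → (a :+ b) :- (c :+ d) := (a :- c) :+ (b :- d)) refl

  diff-* : ∀ a b c d → a ℚ.* b ℚ.- c ℚ.* d ≡ a ℚ.* (b ℚ.- d) ℚ.+ (a ℚ.- c) ℚ.* d
  diff-* = solve 4 (λ a b c d → a :* b :- c :* d := a :* (b :- d) :+ (a :- c) :* d) refl

  common-factor : ∀ B C e i → B ℚ.* (e ℚ.* i) ℚ.+ (e ℚ.* i) ℚ.* C ≡ e ℚ.* ((B ℚ.+ C) ℚ.* i)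
  common-factor = solve 4 (λ B C e i → B :* (e :* i) :+ (e :* i) :* C := e :* ((B :+ C) :* i)) refl

open Identities

half-pos : ∀ {ε} → 0ℚ ℚ.< ε → 0ℚ ℚ.< ½ ℚ.* ε
half-pos {ε} 0<ε = subst (ℚ._< ½ ℚ.* ε) (ℚ.*-zeroʳ ½) (ℚ.*-monoʳ-<-pos ½ 0<ε)

half+half : ∀ ε → ½ ℚ.* ε ℚ.+ ½ ℚ.* ε ≡ ε
half+half ε = trans (sym (ℚ.*-distribʳ-+ ε ½ ½)) (ℚ.*-identityˡ ε)

diff-self : ∀ p → ∣ p ℚ.- p ∣ ≡ 0ℚ
diff-self p = cong ∣_∣ (ℚ.+-inverseʳ p)

p≤q+∣p-q∣ : ∀ p q → p ℚ.≤ q ℚ.+ ∣ p ℚ.- q ∣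
p≤q+∣p-q∣ p q = begin
  p                        ≡⟨ split-diff p q ⟩
  q ℚ.+ (p ℚ.- q)          ≤⟨ ℚ.+-monoʳ-≤ q (p≤∣p∣ (p ℚ.- q)) ⟩
  q ℚ.+ ∣ p ℚ.- q ∣        ∎
  where
  open ℚ.≤-Reasoning
  p≤∣p∣ : ∀ p → p ℚ.≤ ∣ p ∣
  p≤∣p∣ p with ℚ.≤-total 0ℚ p
  ... | _⊎_.inj₁ 0≤p = ℚ.≤-reflexive (sym (ℚ.0≤p⇒∣p∣≡p 0≤p))
  ... | _⊎_.inj₂ p≤0 = ℚ.≤-trans p≤0 (ℚ.0≤∣p∣ p)

∣p∣≤∣q∣+∣p-q∣ : ∀ p q → ∣ p ∣ ℚ.≤ ∣ q ∣ ℚ.+ ∣ p ℚ.- q ∣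
∣p∣≤∣q∣+∣p-q∣ p q =
  subst (λ r → ∣ r ∣ ℚ.≤ ∣ q ∣ ℚ.+ ∣ p ℚ.- q ∣)
        (sym (split-diff p q))
        (ℚ.∣p+q∣≤∣p∣+∣q∣ q (p ℚ.- q))

-- p ≤ r + ε and r ≤ p + ε give ∣ p - r ∣ ≤ ε
∣-∣-bound : ∀ p r {ε} → p ℚ.≤ r ℚ.+ ε → r ℚ.≤ p ℚ.+ ε → ∣ p ℚ.- r ∣ ℚ.≤ ε
∣-∣-bound p r {ε} p≤ r≤ with ℚ.∣p∣≡p∨∣p∣≡-p (p ℚ.- r)
... | _⊎_.inj₁ eq = begin
  ∣ p ℚ.- r ∣             ≡⟨ eq ⟩
  p ℚ.- r                 ≤⟨ ℚ.+-monoˡ-≤ (ℚ.- r) p≤ ⟩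
  (r ℚ.+ ε) ℚ.- r         ≡⟨ cancel r ε ⟩
  ε                       ∎
  where
  open ℚ.≤-Reasoning
... | _⊎_.inj₂ eq = begin
  ∣ p ℚ.- r ∣             ≡⟨ eq ⟩
  ℚ.- (p ℚ.- r)           ≡⟨ neg-diff p r ⟩
  r ℚ.- p                 ≤⟨ ℚ.+-monoˡ-≤ (ℚ.- p) r≤ ⟩
  (p ℚ.+ ε) ℚ.- p         ≡⟨ cancel p ε ⟩
  ε                       ∎
  where
  open ℚ.≤-Reasoning

*-mono-nonNeg : ∀ {p q r s} → 0ℚ ℚ.≤ p → 0ℚ ℚ.≤ s → p ℚ.≤ q → r ℚ.≤ s →
                p ℚ.* r ℚ.≤ q ℚ.* s
*-mono-nonNeg {p} {q} {r} {s} 0≤p 0≤s p≤q r≤s =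
  ℚ.≤-trans (ℚ.*-monoˡ-≤-nonNeg p {{ℚ.nonNegative 0≤p}} r≤s)
            (ℚ.*-monoʳ-≤-nonNeg s {{ℚ.nonNegative 0≤s}} p≤q)

------------------------------------------------------------------------
-- Ring operations

fromℚ : ℚ → ℝ
fromℚ q = mkℝ (λ _ → q) λ ε 0<ε → 0 , λ _ _ _ _ →
  subst (ℚ._≤ ε) (sym (diff-self q)) (ℚ.<⇒≤ 0<ε)

0ℝ 1ℝ : ℝ
0ℝ = fromℚ 0ℚ
1ℝ = fromℚ 1ℚ

infixl 6 _+_ _-_
infixl 7 _*_
infix  8 -_

_+_ : ℝ → ℝ → ℝ
x + y = mkℝ (λ n → seq x n ℚ.+ seq y n) +-cauchy
  where
  +-cauchy : IsCauchy (λ n → seq x n ℚ.+ seq y n)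
  +-cauchy ε 0<ε with cauchy x (½ ℚ.* ε) (half-pos 0<ε) | cauchy y (½ ℚ.* ε) (half-pos 0<ε)
  ... | K , hx | L , hy = K ℕ.⊔ L , λ m n K≤m K≤n →
    let a = seq x m; b = seq y m; c = seq x n; d = seq y n in begin
    ∣ (a ℚ.+ b) ℚ.- (c ℚ.+ d) ∣
      ≡⟨ cong ∣_∣ (diff-+ a b c d) ⟩
    ∣ (a ℚ.- c) ℚ.+ (b ℚ.- d) ∣
      ≤⟨ ℚ.∣p+q∣≤∣p∣+∣q∣ (a ℚ.- c) (b ℚ.- d) ⟩
    ∣ a ℚ.- c ∣ ℚ.+ ∣ b ℚ.- d ∣
      ≤⟨ ℚ.+-mono-≤ (hx m n (ℕ.m⊔n≤o⇒m≤o K L K≤m) (ℕ.m⊔n≤o⇒m≤o K L K≤n))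
                    (hy m n (ℕ.m⊔n≤o⇒n≤o K L K≤m) (ℕ.m⊔n≤o⇒n≤o K L K≤n)) ⟩
    ½ ℚ.* ε ℚ.+ ½ ℚ.* ε
      ≡⟨ half+half ε ⟩
    ε ∎
    where
    open ℚ.≤-Reasoning

-_ : ℝ → ℝ
- x = mkℝ (λ n → ℚ.- seq x n) λ ε 0<ε →
  let K , hx = cauchy x ε 0<ε in K , λ m n K≤m K≤n →
  subst (ℚ._≤ ε)
    (trans (sym (ℚ.∣-p∣≡∣p∣ (seq x m ℚ.- seq x n)))
           (cong ∣_∣ (diff-neg (seq x m) (seq x n))))
    (hx m n K≤m K≤n)

_-_ : ℝ → ℝ → ℝ
x - y = x + (- y)

eventually-bounded : ∀ x → ∃[ B ] 0ℚ ℚ.< B × ∃[ K ] ∀ n → K ℕ.≤ n → ∣ seq x n ∣ ℚ.≤ B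
eventually-bounded x with cauchy x 1ℚ (*<* (+<+ (s≤s z≤n)))
... | K , hx = ∣ seq x K ∣ ℚ.+ 1ℚ
             , ℚ.positive⁻¹ _ {{ℚ.nonNeg+pos⇒pos ∣ seq x K ∣ {{ℚ.∣-∣-nonNeg (seq x K)}} 1ℚ}}
             , K
             , λ n K≤n → ℚ.≤-trans (∣p∣≤∣q∣+∣p-q∣ (seq x n) (seq x K))
                 (ℚ.+-monoʳ-≤ ∣ seq x K ∣ (hx n K K≤n ℕ.≤-refl))

split-tolerance : ∀ {B C ε} → 0ℚ ℚ.< B → 0ℚ ℚ.< C → 0ℚ ℚ.< ε →
                  ∃[ η ] 0ℚ ℚ.< η × B ℚ.* η ℚ.+ η ℚ.* C ≡ ε
split-tolerance {B} {C} {ε} 0<B 0<C 0<ε = inv (B ℚ.+ C) refl (ℚ.pos+pos⇒pos B {{ℚ.positive 0<B}} C {{ℚ.positive 0<C}})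
  where
  inv : ∀ D → D ≡ B ℚ.+ C → ℚ.Positive D → ∃[ η ] 0ℚ ℚ.< η × B ℚ.* η ℚ.+ η ℚ.* C ≡ ε
  inv D D≡ D-pos = ε ℚ.* i
    , ℚ.positive⁻¹ (ε ℚ.* i) {{ℚ.pos*pos⇒pos ε {{ℚ.positive 0<ε}} i {{ℚ.1/pos⇒pos D {{D-pos}}}}}}
    , trans (common-factor B C ε i)
        (trans (cong (λ E → ε ℚ.* (E ℚ.* i)) (sym D≡))
          (trans (cong (ε ℚ.*_) (ℚ.*-inverseʳ D {{D≢0}})) (ℚ.*-identityʳ ε)))
    where
    D≢0 = ℚ.pos⇒nonZero D {{D-pos}}
    i = (ℚ.1/ D) {{D≢0}}

diff-*-bound : ∀ a b c d {B C η} → 0ℚ ℚ.≤ η → 0ℚ ℚ.≤ C →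
               ∣ a ∣ ℚ.≤ B → ∣ b ℚ.- d ∣ ℚ.≤ η → ∣ a ℚ.- c ∣ ℚ.≤ η → ∣ d ∣ ℚ.≤ C →
               ∣ a ℚ.* b ℚ.- c ℚ.* d ∣ ℚ.≤ B ℚ.* η ℚ.+ η ℚ.* C
diff-*-bound a b c d {B} {C} {η} 0≤η 0≤C a≤ b-d≤ a-c≤ d≤ = begin
  ∣ a ℚ.* b ℚ.- c ℚ.* d ∣
    ≡⟨ cong ∣_∣ (diff-* a b c d) ⟩
  ∣ a ℚ.* (b ℚ.- d) ℚ.+ (a ℚ.- c) ℚ.* d ∣
    ≤⟨ ℚ.∣p+q∣≤∣p∣+∣q∣ (a ℚ.* (b ℚ.- d)) ((a ℚ.- c) ℚ.* d) ⟩
  ∣ a ℚ.* (b ℚ.- d) ∣ ℚ.+ ∣ (a ℚ.- c) ℚ.* d ∣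
    ≡⟨ cong₂ ℚ._+_ (ℚ.∣p*q∣≡∣p∣*∣q∣ a (b ℚ.- d)) (ℚ.∣p*q∣≡∣p∣*∣q∣ (a ℚ.- c) d) ⟩
  ∣ a ∣ ℚ.* ∣ b ℚ.- d ∣ ℚ.+ ∣ a ℚ.- c ∣ ℚ.* ∣ d ∣
    ≤⟨ ℚ.+-mono-≤ (*-mono-nonNeg (ℚ.0≤∣p∣ a) 0≤η a≤ b-d≤)
                  (*-mono-nonNeg (ℚ.0≤∣p∣ (a ℚ.- c)) 0≤C a-c≤ d≤) ⟩
  B ℚ.* η ℚ.+ η ℚ.* C ∎
  where open ℚ.≤-Reasoning

_*_ : ℝ → ℝ → ℝ
x * y = mkℝ (λ n → seq x n ℚ.* seq y n) λ ε 0<ε →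
  let B , 0<B , K₁ , bx = eventually-bounded x
      C , 0<C , K₂ , by = eventually-bounded y
      η , 0<η , Bη+ηC≡ε = split-tolerance 0<B 0<C 0<ε
      K₃ , hx = cauchy x η 0<η
      K₄ , hy = cauchy y η 0<η
      L₁ = K₁ ℕ.⊔ K₂
      L₂ = K₃ ℕ.⊔ K₄
  in L₁ ℕ.⊔ L₂ , λ m n K≤m K≤n →
    let L₁≤m = ℕ.m⊔n≤o⇒m≤o L₁ L₂ K≤m
        L₁≤n = ℕ.m⊔n≤o⇒m≤o L₁ L₂ K≤n
        L₂≤m = ℕ.m⊔n≤o⇒n≤o L₁ L₂ K≤m
        L₂≤n = ℕ.m⊔n≤o⇒n≤o L₁ L₂ K≤n
    in subst (∣ seq x m ℚ.* seq y m ℚ.- seq x n ℚ.* seq y n ∣ ℚ.≤_) Bη+ηC≡ε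
      (diff-*-bound (seq x m) (seq y m) (seq x n) (seq y n) (ℚ.<⇒≤ 0<η) (ℚ.<⇒≤ 0<C)
        (bx m (ℕ.m⊔n≤o⇒m≤o K₁ K₂ L₁≤m))
        (hy m n (ℕ.m⊔n≤o⇒n≤o K₃ K₄ L₂≤m) (ℕ.m⊔n≤o⇒n≤o K₃ K₄ L₂≤n))
        (hx m n (ℕ.m⊔n≤o⇒m≤o K₃ K₄ L₂≤m) (ℕ.m⊔n≤o⇒m≤o K₃ K₄ L₂≤n))
        (by n (ℕ.m⊔n≤o⇒n≤o K₁ K₂ L₁≤n)))

------------------------------------------------------------------------
-- Square root

-- ⌊ √ m ⌋
isqrt : ℕ → ℕ
isqrt zero    = 0
isqrt (suc m) = step (isqrt m)
  where
  step : ℕ → ℕ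
  step r = if suc r ℕ.* suc r ℕ.≤ᵇ suc m then suc r else r

isqrt-lower : ∀ m → isqrt m ℕ.* isqrt m ℕ.≤ m
isqrt-lower zero = z≤n
isqrt-lower (suc m) with suc (isqrt m) ℕ.* suc (isqrt m) ℕ.≤ᵇ suc m in eq
... | true  = ℕ.≤ᵇ⇒≤ _ _ (subst T (sym eq) _)
... | false = ℕ.m≤n⇒m≤1+n (isqrt-lower m)

isqrt-upper : ∀ m → m ℕ.< suc (isqrt m) ℕ.* suc (isqrt m)
isqrt-upper zero = s≤s z≤n
isqrt-upper (suc m) with suc (isqrt m) ℕ.* suc (isqrt m) ℕ.≤ᵇ suc m in eq
... | true  = ℕ.≤-<-trans (isqrt-upper m)
                (ℕ.*-mono-< (ℕ.n<1+n (suc (isqrt m))) (ℕ.n<1+n (suc (isqrt m))))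
... | false = ℕ.≰⇒> λ p → subst T eq (ℕ.≤⇒≤ᵇ p)

-- The precision 1/(n+1).
δ : ℕ → ℚ
δ n = + 1 ℚ./ suc n

-- For p = a/b ≥ 0 this is ⌊ √(a b (n+1)²) ⌋ / (b (n+1)), an approximation
-- of √p from below with error less than 1/(n+1).
sqrtℚ : ℕ → ℚ → ℚ
sqrtℚ n p = + isqrt (ℤ.∣ ↥ p ∣ ℕ.* ↧ₙ p ℕ.* (suc n ℕ.* suc n)) ℚ./ (↧ₙ p ℕ.* suc n)

frac : ℕ → ℕ → ℚ
frac r e = + r ℚ./ suc e

toℚᵘ-frac : ∀ r e → ℚ.toℚᵘ (frac r e) ℚᵘ.≃ ℚᵘ.mkℚᵘ (+ r) e
toℚᵘ-frac r e = ℚ.toℚᵘ-fromℚᵘ (ℚᵘ.mkℚᵘ (+ r) e)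

toℚᵘ-frac² : ∀ r e → ℚ.toℚᵘ (frac r e ℚ.* frac r e) ℚᵘ.≃ ℚᵘ.mkℚᵘ (+ r) e ℚᵘ.* ℚᵘ.mkℚᵘ (+ r) e
toℚᵘ-frac² r e = ℚᵘ.≃-trans (ℚ.toℚᵘ-homo-* (frac r e) (frac r e))
                   (ℚᵘ.*-cong (toℚᵘ-frac r e) (toℚᵘ-frac r e))

frac²≤ : ∀ r e a b .{c : Coprime a (suc b)} → r ℕ.* r ℕ.* suc b ℕ.≤ a ℕ.* (suc e ℕ.* suc e) →
         frac r e ℚ.* frac r e ℚ.≤ mkℚ (+ a) b c
frac²≤ r e a b h = ℚ.toℚᵘ-cancel-≤ (ℚᵘ.≤-respˡ-≃ (ℚᵘ.≃-sym (toℚᵘ-frac² r e))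
  (ℚᵘ.*≤* (subst₂ ℤ._≤_
    (trans (ℤ.pos-* (r ℕ.* r) (suc b)) (cong (ℤ._* + suc b) (ℤ.pos-* r r)))
    (ℤ.pos-* a (suc e ℕ.* suc e))
    (+≤+ h))))

<frac² : ∀ r e a b .{c : Coprime a (suc b)} → a ℕ.* (suc e ℕ.* suc e) ℕ.< r ℕ.* r ℕ.* suc b →
         mkℚ (+ a) b c ℚ.< frac r e ℚ.* frac r e
<frac² r e a b h = ℚ.toℚᵘ-cancel-< (ℚᵘ.<-respʳ-≃ (ℚᵘ.≃-sym (toℚᵘ-frac² r e))
  (ℚᵘ.*<* (subst₂ ℤ._<_
    (ℤ.pos-* a (suc e ℕ.* suc e))
    (trans (ℤ.pos-* (r ℕ.* r) (suc b)) (cong (ℤ._* + suc b) (ℤ.pos-* r r)))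
    (+<+ h))))

frac-suc≤ : ∀ r e n → n ℕ.≤ e → frac (suc r) e ℚ.≤ frac r e ℚ.+ δ n
frac-suc≤ r e n n≤e = ℚ.toℚᵘ-cancel-≤
  (ℚᵘ.≤-respˡ-≃ (ℚᵘ.≃-sym (toℚᵘ-frac (suc r) e))
    (ℚᵘ.≤-respʳ-≃ (ℚᵘ.≃-sym (ℚᵘ.≃-trans (ℚ.toℚᵘ-homo-+ (frac r e) (δ n))
                               (ℚᵘ.+-cong (toℚᵘ-frac r e) (toℚᵘ-frac 1 n))))
      (ℚᵘ.*≤* (subst₂ ℤ._≤_
        (ℤ.pos-* (suc r) (suc e ℕ.* suc n))
        (trans (ℤ.pos-* (r ℕ.* suc n ℕ.+ 1 ℕ.* suc e) (suc e))
          (cong (ℤ._* + suc e)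
            (cong₂ ℤ._+_ (ℤ.pos-* r (suc n)) (ℤ.pos-* 1 (suc e)))))
        (+≤+ (begin
          suc r ℕ.* (suc e ℕ.* suc n)
            ≡⟨ solve 3 (λ r e n → (con 1 :+ r) :* (e :* n) := r :* n :* e :+ n :* e) refl r (suc e) (suc n) ⟩
          r ℕ.* suc n ℕ.* suc e ℕ.+ suc n ℕ.* suc e
            ≤⟨ ℕ.+-monoʳ-≤ (r ℕ.* suc n ℕ.* suc e) (ℕ.*-monoˡ-≤ (suc e) (s≤s n≤e)) ⟩
          r ℕ.* suc n ℕ.* suc e ℕ.+ suc e ℕ.* suc e
            ≡⟨ solve 3 (λ r e n → r :* n :* e :+ e :* e := (r :* n :+ con 1 :* e) :* e) refl r (suc e) (suc n) ⟩
          (r ℕ.* suc n ℕ.+ 1 ℕ.* suc e) ℕ.* suc e ∎))))))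
  where
  open ℕ.≤-Reasoning
  open ℕ-Solver.+-*-Solver

clear-denominators : ∀ a b n → a ℕ.* ((b ℕ.* n) ℕ.* (b ℕ.* n)) ≡ a ℕ.* b ℕ.* (n ℕ.* n) ℕ.* b
clear-denominators = solve 3 (λ a b n → a :* ((b :* n) :* (b :* n)) := a :* b :* (n :* n) :* b) refl
  where open ℕ-Solver.+-*-Solver

δ-pos : ∀ n → 0ℚ ℚ.< δ n
δ-pos n = ℚ.positive⁻¹ (δ n) {{ℚ.normalize-pos 1 (suc n)}}

sqrtℚ-nonNeg : ∀ n p → 0ℚ ℚ.≤ sqrtℚ n p
sqrtℚ-nonNeg n p = ℚ.nonNegative⁻¹ (sqrtℚ n p)
  {{ℚ.normalize-nonNeg (isqrt (ℤ.∣ ↥ p ∣ ℕ.* ↧ₙ p ℕ.* (suc n ℕ.* suc n))) (↧ₙ p ℕ.* suc n)}}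

sqrtℚ-lower : ∀ n p → 0ℚ ℚ.≤ p → sqrtℚ n p ℚ.* sqrtℚ n p ℚ.≤ p
sqrtℚ-lower n (mkℚ (+ a) b c) _ =
  frac²≤ r (n ℕ.+ b ℕ.* suc n) a b
    (subst (r ℕ.* r ℕ.* suc b ℕ.≤_) (sym (clear-denominators a (suc b) (suc n)))
      (ℕ.*-monoˡ-≤ (suc b) (isqrt-lower m)))
  where
  m = a ℕ.* suc b ℕ.* (suc n ℕ.* suc n)
  r = isqrt m
sqrtℚ-lower n (mkℚ -[1+ a ] b c) (ℚ.*≤* ())

sqrtℚ-upper : ∀ n p → 0ℚ ℚ.≤ p → p ℚ.< (sqrtℚ n p ℚ.+ δ n) ℚ.* (sqrtℚ n p ℚ.+ δ n)
sqrtℚ-upper n p@(mkℚ (+ a) b c) _ = ℚ.<-≤-trans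
  (<frac² (suc r) e a b
    (subst (ℕ._< suc r ℕ.* suc r ℕ.* suc b) (sym (clear-denominators a (suc b) (suc n)))
      (ℕ.*-monoˡ-< (suc b) (isqrt-upper m))))
  (*-mono-nonNeg 0≤f (ℚ.≤-trans 0≤f f≤) f≤ f≤)
  where
  m = a ℕ.* suc b ℕ.* (suc n ℕ.* suc n)
  r = isqrt m
  e = n ℕ.+ b ℕ.* suc n
  0≤f : 0ℚ ℚ.≤ frac (suc r) e
  0≤f = ℚ.nonNegative⁻¹ (frac (suc r) e) {{ℚ.normalize-nonNeg (suc r) (suc e)}}
  f≤ : frac (suc r) e ℚ.≤ sqrtℚ n p ℚ.+ δ n
  f≤ = frac-suc≤ r e n (ℕ.m≤m+n n (b ℕ.* suc n))
sqrtℚ-upper n (mkℚ -[1+ a ] b c) (ℚ.*≤* ())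

δ-small : ∀ ε → 0ℚ ℚ.< ε → ∃[ K ] ∀ n → K ℕ.≤ n → δ n ℚ.≤ ε
δ-small (mkℚ (+ suc a) b c) _ = b , λ n b≤n → ℚ.toℚᵘ-cancel-≤
  (ℚᵘ.≤-respˡ-≃ (ℚᵘ.≃-sym (toℚᵘ-frac 1 n))
    (ℚᵘ.*≤* (subst₂ ℤ._≤_ (ℤ.pos-* 1 (suc b)) (ℤ.pos-* (suc a) (suc n))
      (+≤+ (ℕ.*-mono-≤ (s≤s (z≤n {a})) (s≤s b≤n))))))
δ-small (mkℚ (+ zero) b c) (*<* (+<+ ()))
δ-small (mkℚ -[1+ a ] b c) (*<* ())

clamp-close : ∀ a b {e} → ∣ a ℚ.- b ∣ ℚ.≤ e → a ℚ.⊔ 0ℚ ℚ.≤ (b ℚ.⊔ 0ℚ) ℚ.+ e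
clamp-close a b {e} h = ℚ.⊔-lub
  (ℚ.≤-trans (p≤q+∣p-q∣ a b) (ℚ.+-mono-≤ (ℚ.p≤p⊔q b 0ℚ) h))
  (ℚ.+-mono-≤ (ℚ.p≤q⊔p b 0ℚ) (ℚ.≤-trans (ℚ.0≤∣p∣ (a ℚ.- b)) h))

squares : ∀ s e → (s ℚ.+ e ℚ.+ e) ℚ.* (s ℚ.+ e ℚ.+ e) ≡
          (s ℚ.+ e) ℚ.* (s ℚ.+ e) ℚ.+ e ℚ.* e ℚ.+ ((s ℚ.+ e) ℚ.* e ℚ.+ (s ℚ.+ e) ℚ.* e)
squares = solve 2 (λ s e → (s :+ e :+ e) :* (s :+ e :+ e) :=
            (s :+ e) :* (s :+ e) :+ e :* e :+ ((s :+ e) :* e :+ (s :+ e) :* e)) refl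
  where open ℚ-Solver.+-*-Solver

-- If s² ≤ p ≤ q + η² and q < (t + d)² with d ≤ η, then s ≤ t + 2η.
sqrt-close : ∀ s t p q d η → 0ℚ ℚ.≤ s → 0ℚ ℚ.≤ t → 0ℚ ℚ.≤ d → d ℚ.≤ η →
             s ℚ.* s ℚ.≤ p → p ℚ.≤ q ℚ.+ η ℚ.* η → q ℚ.< (t ℚ.+ d) ℚ.* (t ℚ.+ d) →
             s ℚ.≤ t ℚ.+ η ℚ.+ η
sqrt-close s t p q d η 0≤s 0≤t 0≤d d≤η s²≤p p≤q+η² q<[t+d]² = ℚ.≮⇒≥ λ t+2η<s →
  ℚ.<-irrefl refl (begin-strict
    s ℚ.* s
      ≤⟨ s²≤p ⟩
    p
      ≤⟨ p≤q+η² ⟩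
    q ℚ.+ η ℚ.* η
      <⟨ ℚ.+-monoˡ-< (η ℚ.* η) q<[t+d]² ⟩
    (t ℚ.+ d) ℚ.* (t ℚ.+ d) ℚ.+ η ℚ.* η
      ≤⟨ ℚ.+-monoˡ-≤ (η ℚ.* η) (*-mono-nonNeg (ℚ.+-mono-≤ 0≤t 0≤d) 0≤t+η t+d≤t+η t+d≤t+η) ⟩
    (t ℚ.+ η) ℚ.* (t ℚ.+ η) ℚ.+ η ℚ.* η
      ≡⟨ ℚ.+-identityʳ _ ⟨
    (t ℚ.+ η) ℚ.* (t ℚ.+ η) ℚ.+ η ℚ.* η ℚ.+ 0ℚ
      ≤⟨ ℚ.+-monoʳ-≤ ((t ℚ.+ η) ℚ.* (t ℚ.+ η) ℚ.+ η ℚ.* η) (ℚ.+-mono-≤ 0≤[t+η]η 0≤[t+η]η) ⟩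
    (t ℚ.+ η) ℚ.* (t ℚ.+ η) ℚ.+ η ℚ.* η ℚ.+ ((t ℚ.+ η) ℚ.* η ℚ.+ (t ℚ.+ η) ℚ.* η)
      ≡⟨ squares t η ⟨
    (t ℚ.+ η ℚ.+ η) ℚ.* (t ℚ.+ η ℚ.+ η)
      ≤⟨ *-mono-nonNeg (ℚ.+-mono-≤ 0≤t+η 0≤η) 0≤s (ℚ.<⇒≤ t+2η<s) (ℚ.<⇒≤ t+2η<s) ⟩
    s ℚ.* s ∎)
  where
  open ℚ.≤-Reasoning
  0≤η : 0ℚ ℚ.≤ η
  0≤η = ℚ.≤-trans 0≤d d≤η
  0≤t+η : 0ℚ ℚ.≤ t ℚ.+ η
  0≤t+η = ℚ.+-mono-≤ 0≤t 0≤η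
  t+d≤t+η : t ℚ.+ d ℚ.≤ t ℚ.+ η
  t+d≤t+η = ℚ.+-monoʳ-≤ t d≤η
  0≤[t+η]η : 0ℚ ℚ.≤ (t ℚ.+ η) ℚ.* η
  0≤[t+η]η = subst (ℚ._≤ (t ℚ.+ η) ℚ.* η) (ℚ.*-zeroˡ 0ℚ) (*-mono-nonNeg ℚ.≤-refl 0≤η 0≤t+η 0≤η)

sqrt-close-clamped : ∀ m n a b {ε} → 0ℚ ℚ.< ε → δ n ℚ.≤ ½ ℚ.* ε →
  ∣ a ℚ.- b ∣ ℚ.≤ (½ ℚ.* ε) ℚ.* (½ ℚ.* ε) →
  sqrtℚ m (a ℚ.⊔ 0ℚ) ℚ.≤ sqrtℚ n (b ℚ.⊔ 0ℚ) ℚ.+ ε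
sqrt-close-clamped m n a b {ε} 0<ε δ≤ a-b≤ =
  subst (sqrtℚ m a⁺ ℚ.≤_)
    (trans (ℚ.+-assoc (sqrtℚ n b⁺) η η) (cong (sqrtℚ n b⁺ ℚ.+_) (half+half ε)))
    (sqrt-close (sqrtℚ m a⁺) (sqrtℚ n b⁺) a⁺ b⁺ (δ n) η
      (sqrtℚ-nonNeg m a⁺) (sqrtℚ-nonNeg n b⁺) (ℚ.<⇒≤ (δ-pos n)) δ≤
      (sqrtℚ-lower m a⁺ (ℚ.p≤q⊔p a 0ℚ)) (clamp-close a b a-b≤)
      (sqrtℚ-upper n b⁺ (ℚ.p≤q⊔p b 0ℚ)))
  where
  η = ½ ℚ.* ε
  a⁺ = a ℚ.⊔ 0ℚ
  b⁺ = b ℚ.⊔ 0ℚ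

-- The square root of max(x, 0).
infix 8 √_

√_ : ℝ → ℝ
√ x = mkℝ (λ n → sqrtℚ n (seq x n ℚ.⊔ 0ℚ)) λ ε 0<ε →
  let η = ½ ℚ.* ε
      0<η = half-pos 0<ε
      K₁ , hx = cauchy x (η ℚ.* η) (ℚ.positive⁻¹ (η ℚ.* η)
                  {{ℚ.pos*pos⇒pos η {{ℚ.positive 0<η}} η {{ℚ.positive 0<η}}}})
      K₂ , hδ = δ-small η 0<η
  in K₁ ℕ.⊔ K₂ , λ m n K≤m K≤n →
    let K₁≤m = ℕ.m⊔n≤o⇒m≤o K₁ K₂ K≤m
        K₁≤n = ℕ.m⊔n≤o⇒m≤o K₁ K₂ K≤n
        K₂≤m = ℕ.m⊔n≤o⇒n≤o K₁ K₂ K≤m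
        K₂≤n = ℕ.m⊔n≤o⇒n≤o K₁ K₂ K≤n
    in ∣-∣-bound (sqrtℚ m (seq x m ℚ.⊔ 0ℚ)) (sqrtℚ n (seq x n ℚ.⊔ 0ℚ))
         (sqrt-close-clamped m n (seq x m) (seq x n) 0<ε (hδ n K₂≤n) (hx m n K₁≤m K₁≤n))
         (sqrt-close-clamped n m (seq x n) (seq x m) 0<ε (hδ m K₂≤m) (hx n m K₁≤n K₁≤m))

------------------------------------------------------------------------
-- The Euclidean plane

Point : Set
Point = ℝ × ℝ

infix 4 _≈ₚ_

_≈ₚ_ : Rel Point 0ℓ
(x₁ , y₁) ≈ₚ (x₂ , y₂) = (x₁ ≈ x₂) × (y₁ ≈ y₂)

dist : Point → Point → ℝ
dist (x₁ , y₁) (x₂ , y₂) = √ ((x₁ - x₂) * (x₁ - x₂) + (y₁ - y₂) * (y₁ - y₂))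

infix 4 _∈[_,_]

_∈[_,_] : Point → Point → Point → Set
X ∈[ (a₁ , a₂) , (b₁ , b₂) ] = ∃[ t ] (0ℝ ≤ t) × (t ≤ 1ℝ) ×
  X ≈ₚ ((1ℝ - t) * a₁ + t * b₁ , (1ℝ - t) * a₂ + t * b₂)

SegmentsIntersect : Point → Point → Point → Point → Set
SegmentsIntersect A B C D = ∃[ X ] X ∈[ A , B ] × X ∈[ C , D ]

------------------------------------------------------------------------
-- Topologies

-- Vertices 0, …, N-1 are the regular points, the last k are the Steiner points.
Vertex : ℕ → ℕ → Set
Vertex N k = Fin (N ℕ.+ k)

steiner : ∀ N {k} → Fin k → Vertex N k
steiner N s = N ↑ʳ s

-- c₀, c₁, …, cₘ₊₂ are distinct, each adjacent to the next, and the last to c₀.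
IsCycle : ∀ {V : Set} → Rel V 0ℓ → ∀ {m} → (Fin (3 ℕ.+ m) → V) → Set
IsCycle Adj {m} c =
  Injective _≡_ _≡_ c ×
  (∀ (i : Fin (2 ℕ.+ m)) → Adj (c (inject₁ i)) (c (suc i))) ×
  Adj (c (fromℕ (2 ℕ.+ m))) (c zero)

record SteinerTopology (N k : ℕ) : Set₁ where
  field
    Adj         : Rel (Vertex N k) 0ℓ
    adj?        : Decidable Adj
    symmetric   : Symmetric Adj
    irreflexive : Irreflexive _≡_ Adj
    connected   : ∀ u v → Star Adj u v
    acyclic     : ∀ {m} (c : Fin (3 ℕ.+ m) → Vertex N k) → ¬ IsCycle Adj c

  degree : Vertex N k → ℕ
  degree v = length (filter (adj? v) (allFin (N ℕ.+ k)))

  field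
    steiner-degree : ∀ s → degree (steiner N s) ≡ 3

FullTopology : ℕ → Set₁
FullTopology N = SteinerTopology N (N ∸ 2)

module _ {N k : ℕ} where

  NeighboursAre : SteinerTopology N k → (v a b c : Vertex N k) → Set
  NeighboursAre T v a b c = ∀ u → SteinerTopology.Adj T v u ⇔ (u ≡ a ⊎ u ≡ b ⊎ u ≡ c)

  -- T′ arises from T by making a, b the neighbours of S other than S′, and
  -- c, d the neighbours of S′ other than S.
  record IsReorganization (T T′ : SteinerTopology N k) (S S′ : Fin k) (a b c d : Vertex N k) : Set where
    field
      neighbours-S  : NeighboursAre T′ (steiner N S) a b (steiner N S′)
      neighbours-S′ : NeighboursAre T′ (steiner N S′) c d (steiner N S)
      unchanged     : ∀ u v → u ≢ steiner N S → u ≢ steiner N S′ → v ≢ steiner N S → v ≢ steiner N S′ →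
                      SteinerTopology.Adj T u v ⇔ SteinerTopology.Adj T′ u v

------------------------------------------------------------------------
-- Steiner trees

Σ[_] : ∀ {n} → Vector ℝ n → ℝ
Σ[_] = foldr _+_ 0ℝ

module _ {N k : ℕ} where

  position : (Fin N → Point) → (Fin k → Point) → Vertex N k → Point
  position P x v = [ P , x ]′ (splitAt N v)

  -- Each edge {u , v} is counted once, as the pair with u < v.
  treeLength : SteinerTopology N k → (Fin N → Point) → (Fin k → Point) → ℝ
  treeLength T P x = Σ[ (λ u → Σ[ (λ v →
    if does (u Fin.<? v ×-dec adj? u v)
    then dist (position P x u) (position P x v)
    else 0ℝ) ]) ]
    where open SteinerTopology T

  IsMinimalTree : SteinerTopology N k → (Fin N → Point) → (Fin k → Point) → Set
  IsMinimalTree T P x = ∀ y → treeLength T P x ≤ treeLength T P y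

  IsMinimalLength : SteinerTopology N k → (Fin N → Point) → ℝ → Set
  IsMinimalLength T P L = ∃[ x ] IsMinimalTree T P x × treeLength T P x ≈ L

{-# OPTIONS --safe #-}
module Submission where

-- Let X lie on both [AB] and [CD]. Placing S and S′ at X turns the five edges
-- around them into edges of total length |AB| + |CD|, whereas by the triangle
-- inequality these edges are always at least |AB| + |CD| + |SS′| long. Hence in
-- a minimal tree |SS′| = 0 and the five edges have length |AB| + |CD|. As S and
-- S′ coincide, the same placement realizes T₁ and T₂ with the same length.

open import Defs
open import Algebra.Bundles using (CommutativeMonoid)
import Algebra.Properties.CommutativeMonoid.Sum as Sum
open import Algebra.Structures using (IsCommutativeMonoid)
open import Data.Bool.Base using (if_then_else_)
open import Data.Empty using (⊥-elim)
open import Data.Fin.Base as Fin using (Fin; punchIn; splitAt)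
import Data.Fin.Properties as Fin
open import Data.Integer.Base as ℤ using ()
open import Data.List.Base using (List; []; _∷_; length; allFin)
open import Data.List.Membership.Propositional using (_∈_)
open import Data.List.Membership.Propositional.Properties using (∈-filter⁻)
open import Data.List.Relation.Unary.All using ([]; _∷_)
open import Data.List.Relation.Unary.AllPairs using ([]; _∷_)
open import Data.List.Relation.Unary.Any using (here; there)
open import Data.List.Relation.Unary.Unique.Propositional using (Unique)
open import Data.List.Relation.Unary.Unique.Propositional.Properties using (filter⁺; allFin⁺)
open import Data.Nat.Base as ℕ using (ℕ; suc; _∸_)
import Data.Nat.Properties as ℕ
open import Data.Product.Base using (_×_; _,_; ∃-syntax; proj₁; proj₂)
open import Data.Rational.Base as ℚ using (ℚ; 0ℚ; 1ℚ; ½)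
import Data.Rational.Properties as ℚ
import Data.Rational.Solver as ℚ-Solver
open import Data.Sum.Base using (_⊎_; inj₁; inj₂; [_,_]′)
open import Data.Vec.Functional using (Vector; removeAt)
open import Function.Base using (_∘_)
open import Function.Bundles using (Equivalence)
open import Level using (0ℓ)
open import Relation.Binary.Bundles using (Poset)
open import Relation.Binary.Construct.Union as Union using (_∪_)
open import Relation.Binary.Core using (Rel; _⇒_)
open import Relation.Binary.Definitions using (Decidable; Symmetric; tri<; tri≈; tri>)
open import Relation.Binary.PropositionalEquality
  using (_≡_; _≢_; refl; sym; trans; cong; cong₂; subst; subst₂)
import Relation.Binary.Reasoning.PartialOrder as PartialOrderReasoning
import Relation.Binary.Reasoning.Setoid as SetoidReasoning
open import Relation.Nullary.Decidable
  using (Dec; does; yes; no; _×-dec_; _⊎-dec_; ¬?; dec-true; dec-false)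
open import Relation.Nullary.Negation using (¬_; contradiction)

-- The order and the equality of real numbers

-- Minimality speaks of whole trees, the geometric estimate of five edges. The bridge is a splitting
-- of `treeLength` into those five edges and `awayLength`, the sum over the edges that touch neither
-- `S` nor `S′`. This remainder is unaffected by moving `S` and `S′`, so it cancels when two
-- placements are compared, and it is common to the three topologies, so reorganizing changes only
-- the five edges. The splitting requires that each edge at `S` or `S′` be counted exactly once; the
-- distinctness this takes is extracted from the degree condition. The other obstacle is that signs
-- of real numbers cannot be decided and that inequalities hold along the sequences only up to every
-- positive tolerance. Inequalities between norms are therefore reduced to inequalities between
-- squares, which are ring facts checked termwise over ℚ, and the squares are then cancelled with
-- explicit slack. In the same spirit |SS′| = 0 is reached by cancelling down to |SS′| ≤ 0, with no
-- case distinction on whether `S` and `S′` coincide.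

Eventually : (ℕ → Set) → Set
Eventually P = ∃[ K ] ∀ n → K ℕ.≤ n → P n

zipWith : ∀ {P Q R : ℕ → Set} → (∀ n → P n → Q n → R n) →
          Eventually P → Eventually Q → Eventually R
zipWith f (K , p) (L , q) = K ℕ.⊔ L , λ n K⊔L≤n →
  f n (p n (ℕ.m⊔n≤o⇒m≤o K L K⊔L≤n)) (q n (ℕ.m⊔n≤o⇒n≤o K L K⊔L≤n))

mapEventually : ∀ {P Q : ℕ → Set} → (∀ n → P n → Q n) → Eventually P → Eventually Q
mapEventually f (K , p) = K , λ n K≤n → f n (p n K≤n)

-- _≤_ and _≈_ unfold to statements about the underlying sequences, from which
-- unification cannot recover the real numbers; these wrappers do not unfold.
-- Sums, products and roots still unfold, down to their convergence proofs, so
-- the implicit arguments of lemmas about them are supplied throughout.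
infix 4 _≲_ _≃_

record _≲_ (x y : ℝ) : Set where
  constructor ≤⇒≲
  field ≲⇒≤ : x ≤ y

open _≲_

record _≃_ (x y : ℝ) : Set where
  constructor ≈⇒≃
  field ≃⇒≈ : x ≈ y

open _≃_

pointwise-≲ : ∀ {x y} → (∀ n → seq x n ℚ.≤ seq y n) → x ≲ y
pointwise-≲ {x} {y} x≤y = ≤⇒≲ λ ε 0<ε → 0 , λ n _ →
  subst (ℚ._≤ seq y n ℚ.+ ε) (ℚ.+-identityʳ (seq x n)) (ℚ.+-mono-≤ (x≤y n) (ℚ.<⇒≤ 0<ε))

≲-trans : ∀ {x y z} → x ≲ y → y ≲ z → x ≲ z
≲-trans {x} {y} {z} (≤⇒≲ x≤y) (≤⇒≲ y≤z) = ≤⇒≲ λ ε 0<ε →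
  zipWith (λ n x≤y+½ε y≤z+½ε → begin
      seq x n                              ≤⟨ x≤y+½ε ⟩
      seq y n ℚ.+ ½ ℚ.* ε                  ≤⟨ ℚ.+-monoˡ-≤ (½ ℚ.* ε) y≤z+½ε ⟩
      seq z n ℚ.+ ½ ℚ.* ε ℚ.+ ½ ℚ.* ε      ≡⟨ ℚ.+-assoc (seq z n) (½ ℚ.* ε) (½ ℚ.* ε) ⟩
      seq z n ℚ.+ (½ ℚ.* ε ℚ.+ ½ ℚ.* ε)    ≡⟨ cong (seq z n ℚ.+_) (half+half ε) ⟩
      seq z n ℚ.+ ε                        ∎)
    (x≤y (½ ℚ.* ε) (half-pos 0<ε)) (y≤z (½ ℚ.* ε) (half-pos 0<ε))
  where open ℚ.≤-Reasoning

≃⇒≲ : ∀ {x y} → x ≃ y → x ≲ y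
≃⇒≲ {x} {y} (≈⇒≃ x≈y) = ≤⇒≲ λ ε 0<ε → mapEventually
  (λ n ∣x-y∣≤ε → ℚ.≤-trans (p≤q+∣p-q∣ (seq x n) (seq y n)) (ℚ.+-monoʳ-≤ (seq y n) ∣x-y∣≤ε))
  (x≈y ε 0<ε)

≲-antisym : ∀ {x y} → x ≲ y → y ≲ x → x ≃ y
≲-antisym {x} {y} (≤⇒≲ x≤y) (≤⇒≲ y≤x) = ≈⇒≃ λ ε 0<ε →
  zipWith (λ n → ∣-∣-bound (seq x n) (seq y n)) (x≤y ε 0<ε) (y≤x ε 0<ε)

≃-sym : ∀ {x y} → x ≃ y → y ≃ x
≃-sym {x} {y} (≈⇒≃ x≈y) = ≈⇒≃ λ ε 0<ε → mapEventually
  (λ n → subst (ℚ._≤ ε) (trans (sym (ℚ.∣-p∣≡∣p∣ (seq x n ℚ.- seq y n)))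
                               (cong ℚ.∣_∣ (Identities.neg-diff (seq x n) (seq y n)))))
  (x≈y ε 0<ε)

≃⇒≳ : ∀ {x y} → x ≃ y → y ≲ x
≃⇒≳ x≃y = ≃⇒≲ (≃-sym x≃y)

≃-trans : ∀ {x y z} → x ≃ y → y ≃ z → x ≃ z
≃-trans x≃y y≃z = ≲-antisym (≲-trans (≃⇒≲ x≃y) (≃⇒≲ y≃z)) (≲-trans (≃⇒≳ y≃z) (≃⇒≳ x≃y))

-- The ring operations act termwise on sequences, so every ring identity between reals becomes a
-- rational identity at each index, within reach of the ring solver for ℚ.
pointwise-≃ : ∀ {x y} → (∀ n → seq x n ≡ seq y n) → x ≃ y
pointwise-≃ x≡y = ≲-antisym (pointwise-≲ λ n → ℚ.≤-reflexive (x≡y n))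
                            (pointwise-≲ λ n → ℚ.≤-reflexive (sym (x≡y n)))

≡⇒≃ : ∀ {x y} → x ≡ y → x ≃ y
≡⇒≃ refl = pointwise-≃ λ _ → refl

≃-refl : ∀ {x} → x ≃ x
≃-refl = ≡⇒≃ refl

ℝ-poset : Poset 0ℓ 0ℓ 0ℓ
ℝ-poset = record
  { Carrier = ℝ ; _≈_ = _≃_ ; _≤_ = _≲_
  ; isPartialOrder = record
    { isPreorder = record
      { isEquivalence = record { refl = ≃-refl ; sym = ≃-sym ; trans = ≃-trans }
      ; reflexive = ≃⇒≲
      ; trans = ≲-trans
      }
    ; antisym = ≲-antisym
    }
  }

module ℝ-Reasoning = PartialOrderReasoning ℝ-poset

-- Arithmetic of real numbers

+-mono-≲ : ∀ {x y u v} → x ≲ y → u ≲ v → x + u ≲ y + v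
+-mono-≲ {x} {y} {u} {v} (≤⇒≲ x≤y) (≤⇒≲ u≤v) = ≤⇒≲ λ ε 0<ε →
  zipWith (λ n x≤y+½ε u≤v+½ε → begin
      seq x n ℚ.+ seq u n
        ≤⟨ ℚ.+-mono-≤ x≤y+½ε u≤v+½ε ⟩
      (seq y n ℚ.+ ½ ℚ.* ε) ℚ.+ (seq v n ℚ.+ ½ ℚ.* ε)
        ≡⟨ solve 3 (λ y v h → (y :+ h) :+ (v :+ h) := (y :+ v) :+ (h :+ h)) refl
             (seq y n) (seq v n) (½ ℚ.* ε) ⟩
      (seq y n ℚ.+ seq v n) ℚ.+ (½ ℚ.* ε ℚ.+ ½ ℚ.* ε)
        ≡⟨ cong (seq y n ℚ.+ seq v n ℚ.+_) (half+half ε) ⟩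
      (seq y n ℚ.+ seq v n) ℚ.+ ε ∎)
    (x≤y (½ ℚ.* ε) (half-pos 0<ε)) (u≤v (½ ℚ.* ε) (half-pos 0<ε))
  where
  open ℚ.≤-Reasoning
  open ℚ-Solver.+-*-Solver

neg-antimono-≲ : ∀ {x y} → x ≲ y → - y ≲ - x
neg-antimono-≲ {x} {y} (≤⇒≲ x≤y) = ≤⇒≲ λ ε 0<ε → mapEventually
  (λ n x≤y+ε → begin
    ℚ.- seq y n                    ≡⟨ solve 2 (λ y e → :- y := :- (y :+ e) :+ e) refl (seq y n) ε ⟩
    ℚ.- (seq y n ℚ.+ ε) ℚ.+ ε      ≤⟨ ℚ.+-monoˡ-≤ ε (ℚ.neg-antimono-≤ x≤y+ε) ⟩
    ℚ.- seq x n ℚ.+ ε              ∎)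
  (x≤y ε 0<ε)
  where
  open ℚ.≤-Reasoning
  open ℚ-Solver.+-*-Solver

+-cong : ∀ {x y u v} → x ≃ y → u ≃ v → x + u ≃ y + v
+-cong {x} {y} {u} {v} x≃y u≃v = ≲-antisym
  (+-mono-≲ {x} {y} {u} {v} (≃⇒≲ x≃y) (≃⇒≲ u≃v)) (+-mono-≲ {y} {x} {v} {u} (≃⇒≳ x≃y) (≃⇒≳ u≃v))

neg-cong : ∀ {x y} → x ≃ y → - x ≃ - y
neg-cong {x} {y} x≃y = ≲-antisym (neg-antimono-≲ {y} {x} (≃⇒≳ x≃y)) (neg-antimono-≲ {x} {y} (≃⇒≲ x≃y))

+-cancelʳ-≲ : ∀ {x y} z → x + z ≲ y + z → x ≲ y
+-cancelʳ-≲ {x} {y} z x+z≲y+z = begin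
  x              ≈⟨ add-sub x ⟩
  (x + z) - z    ≤⟨ +-mono-≲ {x + z} {y + z} { - z} { - z} x+z≲y+z (≃⇒≲ ≃-refl) ⟩
  (y + z) - z    ≈⟨ add-sub y ⟨
  y              ∎
  where
  open ℝ-Reasoning
  open ℚ-Solver.+-*-Solver
  add-sub : ∀ w → w ≃ (w + z) - z
  add-sub w = pointwise-≃ λ n → solve 2 (λ w z → w := (w :+ z) :- z) refl (seq w n) (seq z n)

≲⇒0≲- : ∀ {x y} → x ≲ y → 0ℝ ≲ y - x
≲⇒0≲- {x} {y} x≲y = begin
  0ℝ       ≈⟨ pointwise-≃ (λ n → ℚ.+-inverseʳ (seq x n)) ⟨
  x - x    ≤⟨ +-mono-≲ {x} {y} { - x} { - x} x≲y (≃⇒≲ ≃-refl) ⟩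
  y - x    ∎
  where open ℝ-Reasoning

0≲-⇒≲ : ∀ {x y} → 0ℝ ≲ y - x → x ≲ y
0≲-⇒≲ {x} {y} 0≲y-x = +-cancelʳ-≲ (- x) (begin
  x - x    ≈⟨ pointwise-≃ (λ n → ℚ.+-inverseʳ (seq x n)) ⟩
  0ℝ       ≤⟨ 0≲y-x ⟩
  y - x    ∎)
  where open ℝ-Reasoning

+-commutativeMonoid : CommutativeMonoid 0ℓ 0ℓ
+-commutativeMonoid = record
  { Carrier = ℝ ; _≈_ = _≃_ ; _∙_ = _+_ ; ε = 0ℝ
  ; isCommutativeMonoid = record
    { isMonoid = record
      { isSemigroup = record
        { isMagma = record
          { isEquivalence = Poset.isEquivalence ℝ-poset
          ; ∙-cong = +-cong
          }
        ; assoc = λ x y z → pointwise-≃ λ n → ℚ.+-assoc (seq x n) (seq y n) (seq z n)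
        }
      ; identity = (λ x → pointwise-≃ λ n → ℚ.+-identityˡ (seq x n))
                 , (λ x → pointwise-≃ λ n → ℚ.+-identityʳ (seq x n))
      }
    ; comm = λ x y → pointwise-≃ λ n → ℚ.+-comm (seq x n) (seq y n)
    }
  }

-- From xu - yv = x(u - v) + (x - y)v: only `x` and `v` have to be bounded, by B and C, and a common
-- error η in both factors then costs at most Bη + ηC.
*-cong : ∀ {x y u v} → x ≃ y → u ≃ v → x * u ≃ y * v
*-cong {x} {y} {u} {v} (≈⇒≃ x≈y) (≈⇒≃ u≈v) = ≈⇒≃ λ ε 0<ε →
  let B , 0<B , x-bounded = eventually-bounded x
      C , 0<C , v-bounded = eventually-bounded v
      η , 0<η , Bη+ηC≡ε   = split-tolerance 0<B 0<C 0<ε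
  in zipWith
       (λ n (∣x∣≤B , ∣v∣≤C) (∣x-y∣≤η , ∣u-v∣≤η) →
         subst (ℚ.∣ seq x n ℚ.* seq u n ℚ.- seq y n ℚ.* seq v n ∣ ℚ.≤_) Bη+ηC≡ε
           (diff-*-bound (seq x n) (seq u n) (seq y n) (seq v n) (ℚ.<⇒≤ 0<η) (ℚ.<⇒≤ 0<C)
              ∣x∣≤B ∣u-v∣≤η ∣x-y∣≤η ∣v∣≤C))
       (zipWith (λ _ → _,_) x-bounded v-bounded)
       (zipWith (λ _ → _,_) (x≈y η 0<η) (u≈v η 0<η))

*-nonNegℚ : ∀ {p q} → 0ℚ ℚ.≤ p → 0ℚ ℚ.≤ q → 0ℚ ℚ.≤ p ℚ.* q
*-nonNegℚ {p} {q} 0≤p 0≤q = subst (ℚ._≤ p ℚ.* q) (ℚ.*-zeroˡ 0ℚ) (*-mono-nonNeg ℚ.≤-refl 0≤q 0≤p 0≤q)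

²-posℚ : ∀ {p} → 0ℚ ℚ.< p → 0ℚ ℚ.< p ℚ.* p
²-posℚ {p} 0<p = ℚ.positive⁻¹ (p ℚ.* p) {{ℚ.pos*pos⇒pos p {{ℚ.positive 0<p}} p {{ℚ.positive 0<p}}}}

²-nonNegℚ : ∀ p → 0ℚ ℚ.≤ p ℚ.* p
²-nonNegℚ p = subst (0ℚ ℚ.≤_) ∣p∣*∣p∣≡p*p (*-nonNegℚ (ℚ.0≤∣p∣ p) (ℚ.0≤∣p∣ p))
  where
  open ℚ-Solver.+-*-Solver
  ∣p∣*∣p∣≡p*p : ℚ.∣ p ∣ ℚ.* ℚ.∣ p ∣ ≡ p ℚ.* p
  ∣p∣*∣p∣≡p*p with ℚ.∣p∣≡p∨∣p∣≡-p p
  ... | inj₁ ∣p∣≡p  = cong (λ q → q ℚ.* q) ∣p∣≡p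
  ... | inj₂ ∣p∣≡-p = trans (cong (λ q → q ℚ.* q) ∣p∣≡-p)
                                (solve 1 (λ p → (:- p) :* (:- p) := p :* p) refl p)

²-nonNeg : ∀ x → 0ℝ ≲ x * x
²-nonNeg x = pointwise-≲ λ n → ²-nonNegℚ (seq x n)

²-distrib-* : ∀ x y → (x * y) * (x * y) ≃ (x * x) * (y * y)
²-distrib-* x y = pointwise-≃ λ n →
  solve 2 (λ x y → (x :* y) :* (x :* y) := (x :* x) :* (y :* y)) refl (seq x n) (seq y n)
  where open ℚ-Solver.+-*-Solver

-- The terms of a nonnegative real may be slightly negative, so t ≥ 0 is also available only up to
-- η. If s exceeded t + 4η, which is at least 3η, then s² would be at least (t + 4η)², which is more
-- than t² + η². The argument by contradiction takes place over ℚ, where the order is decidable. The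
-- factor 4 is a convenient choice: it turns into ε after two halvings.
²-cancel-≤ℚ : ∀ {s t η} → 0ℚ ℚ.< η → 0ℚ ℚ.≤ t ℚ.+ η → s ℚ.* s ℚ.≤ t ℚ.* t ℚ.+ η ℚ.* η →
              s ℚ.≤ t ℚ.+ (η ℚ.+ η ℚ.+ (η ℚ.+ η))
²-cancel-≤ℚ {s} {t} {η} 0<η 0≤t+η s²≤t²+η² = ℚ.≮⇒≥ λ t+4η<s →
  ℚ.<-irrefl refl (begin-strict
    s ℚ.* s                           ≤⟨ s²≤t²+η² ⟩
    t ℚ.* t ℚ.+ η²                    ≡⟨ ℚ.+-identityʳ _ ⟨
    t ℚ.* t ℚ.+ η² ℚ.+ 0ℚ             <⟨ ℚ.+-monoʳ-< (t ℚ.* t ℚ.+ η²) 0<excess ⟩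
    t ℚ.* t ℚ.+ η² ℚ.+ excess         ≡⟨ solve 2 (λ t η →
                                           t :* t :+ η :* η :+
                                           (η :* η :+ (con 6ℚ :* (η :* η) :+ con 8ℚ :* ((t :+ η) :* η)))
                                           := (t :+ (η :+ η :+ (η :+ η))) :* (t :+ (η :+ η :+ (η :+ η))))
                                           refl t η ⟩
    t+4η ℚ.* t+4η                     ≤⟨ *-mono-nonNeg 0≤t+4η (ℚ.≤-trans 0≤t+4η (ℚ.<⇒≤ t+4η<s))
                                           (ℚ.<⇒≤ t+4η<s) (ℚ.<⇒≤ t+4η<s) ⟩
    s ℚ.* s                           ∎)
  where
  open ℚ.≤-Reasoning
  open ℚ-Solver.+-*-Solver
  6ℚ 8ℚ η² excess t+4η : ℚ
  6ℚ = ℤ.+ 6 ℚ./ 1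
  8ℚ = ℤ.+ 8 ℚ./ 1
  η² = η ℚ.* η
  -- This is (t + 4η)² - t² - η² = 8tη + 15η², rewritten as 7η² + 8(t + η)η so that only the
  -- nonnegative t + η occurs. One η² is kept apart to make the inequality strict.
  excess = η² ℚ.+ (6ℚ ℚ.* η² ℚ.+ 8ℚ ℚ.* ((t ℚ.+ η) ℚ.* η))
  t+4η = t ℚ.+ (η ℚ.+ η ℚ.+ (η ℚ.+ η))
  0≤η = ℚ.<⇒≤ 0<η
  0<η² : 0ℚ ℚ.< η²
  0<η² = ²-posℚ 0<η
  0<excess : 0ℚ ℚ.< excess
  0<excess = ℚ.+-mono-<-≤ 0<η² (ℚ.+-mono-≤
    (*-nonNegℚ (ℚ.nonNegative⁻¹ 6ℚ) (ℚ.<⇒≤ 0<η²))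
    (*-nonNegℚ (ℚ.nonNegative⁻¹ 8ℚ) (*-nonNegℚ 0≤t+η 0≤η)))
  0≤t+4η : 0ℚ ℚ.≤ t+4η
  0≤t+4η = subst (0ℚ ℚ.≤_)
    (solve 2 (λ t η → (t :+ η) :+ (η :+ (η :+ η)) := t :+ (η :+ η :+ (η :+ η))) refl t η)
    (ℚ.+-mono-≤ 0≤t+η (ℚ.+-mono-≤ 0≤η (ℚ.+-mono-≤ 0≤η 0≤η)))

-- The device behind every comparison of norms below: squaring removes the roots. `x` may have any
-- sign, since a negative `x` only makes the claim easier.
²-cancel-≲ : ∀ {x y} → 0ℝ ≲ y → x * x ≲ y * y → x ≲ y
²-cancel-≲ {x} {y} (≤⇒≲ 0≤y) (≤⇒≲ x²≤y²) = ≤⇒≲ λ ε 0<ε →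
  let η   = ½ ℚ.* (½ ℚ.* ε)
      0<η = half-pos (half-pos 0<ε)
  in zipWith
       (λ n 0≤y+η x²≤y²+η² →
         subst (λ e → seq x n ℚ.≤ seq y n ℚ.+ e)
           (trans (cong (λ e → e ℚ.+ e) (half+half (½ ℚ.* ε))) (half+half ε))
           (²-cancel-≤ℚ {seq x n} {seq y n} 0<η 0≤y+η x²≤y²+η²))
       (0≤y η 0<η)
       (x²≤y² (η ℚ.* η) (²-posℚ 0<η))

²-cancel-≃ : ∀ {x y} → 0ℝ ≲ x → 0ℝ ≲ y → x * x ≃ y * y → x ≃ y
²-cancel-≃ {x} {y} 0≲x 0≲y x²≃y² = ≲-antisym
  (²-cancel-≲ {x} {y} 0≲y (≃⇒≲ x²≃y²)) (²-cancel-≲ {y} {x} 0≲x (≃⇒≳ x²≃y²))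

-- Square roots of real numbers

√-nonNeg : ∀ x → 0ℝ ≲ √ x
√-nonNeg x = pointwise-≲ λ n → sqrtℚ-nonNeg n (seq x n ℚ.⊔ 0ℚ)

√-cong : ∀ {x y} → x ≃ y → √ x ≃ √ y
√-cong {x} {y} x≃y = ≲-antisym (√-mono {x} {y} x≃y) (√-mono {y} {x} (≃-sym x≃y))
  where
  √-mono : ∀ {x y} → x ≃ y → √ x ≲ √ y
  √-mono {x} {y} (≈⇒≃ x≈y) = ≤⇒≲ λ ε 0<ε →
    let η   = ½ ℚ.* ε
        0<η = half-pos 0<ε
    -- A change of the radicand by at most η² moves the root by at most 2η = ε, once the precision
    -- `δ n` of the approximation is below η.
    in zipWith (λ n → sqrt-close-clamped n n (seq x n) (seq y n) 0<ε)
         (δ-small η 0<η)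
         (x≈y (η ℚ.* η) (²-posℚ 0<η))

-- The approximants s lie below the root of the clamped term and within `δ n` of it. Hence s² stays
-- below that term, and the term stays below (s + `δ n`)², whose surplus over s² vanishes because s
-- is bounded.
√-square : ∀ {x} → 0ℝ ≲ x → √ x * √ x ≃ x
√-square {x} (≤⇒≲ 0≤x) = ≲-antisym below above
  where
  open ℚ.≤-Reasoning
  open ℚ-Solver.+-*-Solver

  x⁺ : ℕ → ℚ
  x⁺ n = seq x n ℚ.⊔ 0ℚ

  s : ℕ → ℚ
  s = seq (√ x)

  below : √ x * √ x ≲ x
  below = ≤⇒≲ λ ε 0<ε → mapEventually
    (λ n 0≤x+ε → ℚ.≤-trans (sqrtℚ-lower n (x⁺ n) (ℚ.p≤q⊔p (seq x n) 0ℚ))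
      (ℚ.⊔-lub (subst (ℚ._≤ seq x n ℚ.+ ε) (ℚ.+-identityʳ (seq x n))
                  (ℚ.+-monoʳ-≤ (seq x n) (ℚ.<⇒≤ 0<ε)))
               0≤x+ε))
    (0≤x ε 0<ε)

  above : x ≲ √ x * √ x
  above = ≤⇒≲ λ ε 0<ε →
    let B , 0<B , s-bounded = eventually-bounded (√ x)
        0<1 = ℚ.positive⁻¹ 1ℚ
        -- The surplus is sδ + δ(s + δ). Eventually δ ≤ 1, so the two cofactors of δ are bounded by
        -- B and B + 1.
        η , 0<η , Bη+η[B+1]≡ε = split-tolerance 0<B (ℚ.+-mono-< 0<B 0<1) 0<ε
    in zipWith
         (λ n ∣s∣≤B (δ≤η , δ≤1) →
           let 0≤s = sqrtℚ-nonNeg n (x⁺ n)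
               s≤B = subst (ℚ._≤ B) (ℚ.0≤p⇒∣p∣≡p 0≤s) ∣s∣≤B
               0≤δ = ℚ.<⇒≤ (δ-pos n)
               0≤B+1 = ℚ.<⇒≤ (ℚ.+-mono-< 0<B 0<1)
           in begin
           seq x n
             ≤⟨ ℚ.p≤p⊔q (seq x n) 0ℚ ⟩
           x⁺ n
             ≤⟨ ℚ.<⇒≤ (sqrtℚ-upper n (x⁺ n) (ℚ.p≤q⊔p (seq x n) 0ℚ)) ⟩
           (s n ℚ.+ δ n) ℚ.* (s n ℚ.+ δ n)
             ≡⟨ solve 2 (λ s d → (s :+ d) :* (s :+ d) := s :* s :+ (s :* d :+ d :* (s :+ d)))
                  refl (s n) (δ n) ⟩
           s n ℚ.* s n ℚ.+ (s n ℚ.* δ n ℚ.+ δ n ℚ.* (s n ℚ.+ δ n))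
             ≤⟨ ℚ.+-monoʳ-≤ (s n ℚ.* s n) (ℚ.+-mono-≤
                  (*-mono-nonNeg 0≤s (ℚ.<⇒≤ 0<η) s≤B δ≤η)
                  (*-mono-nonNeg 0≤δ 0≤B+1 δ≤η (ℚ.+-mono-≤ s≤B δ≤1))) ⟩
           s n ℚ.* s n ℚ.+ (B ℚ.* η ℚ.+ η ℚ.* (B ℚ.+ 1ℚ))
             ≡⟨ cong (s n ℚ.* s n ℚ.+_) Bη+η[B+1]≡ε ⟩
           s n ℚ.* s n ℚ.+ ε ∎)
         s-bounded
         (zipWith (λ _ → _,_) (δ-small η 0<η) (δ-small 1ℚ 0<1))

√-of-square : ∀ {x} → 0ℝ ≲ x → √ (x * x) ≃ x
√-of-square {x} 0≲x = ²-cancel-≃ {√ (x * x)} {x} (√-nonNeg (x * x)) 0≲x (√-square {x * x} (²-nonNeg x))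

-- Square roots are nonnegative termwise, unlike the sequences of x and y.
*-nonNeg : ∀ {x y} → 0ℝ ≲ x → 0ℝ ≲ y → 0ℝ ≲ x * y
*-nonNeg {x} {y} 0≲x 0≲y = begin
  0ℝ                       ≤⟨ pointwise-≲ {0ℝ} {√ (x * x) * √ (y * y)} (λ n → *-nonNegℚ
                             (sqrtℚ-nonNeg n (seq (x * x) n ℚ.⊔ 0ℚ))
                             (sqrtℚ-nonNeg n (seq (y * y) n ℚ.⊔ 0ℚ))) ⟩
  √ (x * x) * √ (y * y)    ≈⟨ *-cong {√ (x * x)} {x} {√ (y * y)} {y}
                             (√-of-square {x} 0≲x) (√-of-square {y} 0≲y) ⟩
  x * y                    ∎
  where open ℝ-Reasoning

-- The Euclidean norm and distance

opaque
  -- Opaque, so that comparing expressions in norms does not unfold the roots and their convergence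
  -- proofs; the two equations that follow are the way back.
  norm : ℝ → ℝ → ℝ
  norm a b = √ (a * a + b * b)

  norm≡√ : ∀ a b → norm a b ≡ √ (a * a + b * b)
  norm≡√ a b = refl

  dist≡norm : ∀ x₁ x₂ y₁ y₂ → dist (x₁ , x₂) (y₁ , y₂) ≡ norm (x₁ - y₁) (x₂ - y₂)
  dist≡norm x₁ x₂ y₁ y₂ = refl

dist≃norm : ∀ x₁ x₂ y₁ y₂ → dist (x₁ , x₂) (y₁ , y₂) ≃ norm (x₁ - y₁) (x₂ - y₂)
dist≃norm x₁ x₂ y₁ y₂ = ≡⇒≃ (dist≡norm x₁ x₂ y₁ y₂)

norm-nonNeg : ∀ a b → 0ℝ ≲ norm a b
norm-nonNeg a b = subst (0ℝ ≲_) (sym (norm≡√ a b)) (√-nonNeg (a * a + b * b))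

norm-square : ∀ a b → norm a b * norm a b ≃ a * a + b * b
norm-square a b = ≃-trans {norm a b * norm a b} {√ (a * a + b * b) * √ (a * a + b * b)} {a * a + b * b}
  (*-cong {norm a b} {√ (a * a + b * b)} {norm a b} {√ (a * a + b * b)}
    (≡⇒≃ (norm≡√ a b)) (≡⇒≃ (norm≡√ a b)))
  (√-square {a * a + b * b} (pointwise-≲ {0ℝ} {a * a + b * b} λ n →
    ℚ.+-mono-≤ (²-nonNegℚ (seq a n)) (²-nonNegℚ (seq b n))))

norm-cong² : ∀ {a b c d} → a * a + b * b ≃ c * c + d * d → norm a b ≃ norm c d
norm-cong² {a} {b} {c} {d} eq = subst₂ _≃_ (sym (norm≡√ a b)) (sym (norm≡√ c d))
  (√-cong {a * a + b * b} {c * c + d * d} eq)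

norm-cong : ∀ {a b c d} → a ≃ c → b ≃ d → norm a b ≃ norm c d
norm-cong {a} {b} {c} {d} a≃c b≃d = norm-cong² {a} {b} {c} {d}
  (+-cong {a * a} {c * c} {b * b} {d * d}
    (*-cong {a} {c} {a} {c} a≃c a≃c) (*-cong {b} {d} {b} {d} b≃d b≃d))

norm-neg : ∀ a b → norm (- a) (- b) ≃ norm a b
norm-neg a b = norm-cong² { - a} { - b} {a} {b} (pointwise-≃ λ n →
  solve 2 (λ a b → :- a :* :- a :+ :- b :* :- b := a :* a :+ b :* b) refl (seq a n) (seq b n))
  where open ℚ-Solver.+-*-Solver

-- After squaring, Lagrange's identity leaves the difference (ad - bc)², which is nonnegative term
-- by term.
cauchy-schwarz : ∀ a b c d → a * c + b * d ≲ norm a b * norm c d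
cauchy-schwarz a b c d = ²-cancel-≲ {a * c + b * d} {norm a b * norm c d}
  (*-nonNeg {norm a b} {norm c d} (norm-nonNeg a b) (norm-nonNeg c d)) (begin
    (a * c + b * d) * (a * c + b * d)
      ≤⟨ pointwise-≲ {(a * c + b * d) * (a * c + b * d)} {(a * a + b * b) * (c * c + d * d)} (λ n →
           lagrange (seq a n) (seq b n) (seq c n) (seq d n)) ⟩
    (a * a + b * b) * (c * c + d * d)
      ≈⟨ *-cong {norm a b * norm a b} {a * a + b * b} {norm c d * norm c d} {c * c + d * d}
           (norm-square a b) (norm-square c d) ⟨
    (norm a b * norm a b) * (norm c d * norm c d)
      ≈⟨ ²-distrib-* (norm a b) (norm c d) ⟨
    (norm a b * norm c d) * (norm a b * norm c d) ∎)
  where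
  open ℝ-Reasoning
  open ℚ-Solver.+-*-Solver
  lagrange : ∀ a b c d → (a ℚ.* c ℚ.+ b ℚ.* d) ℚ.* (a ℚ.* c ℚ.+ b ℚ.* d)
                       ℚ.≤ (a ℚ.* a ℚ.+ b ℚ.* b) ℚ.* (c ℚ.* c ℚ.+ d ℚ.* d)
  lagrange a b c d = subst₂ ℚ._≤_
    (ℚ.+-identityʳ ((a ℚ.* c ℚ.+ b ℚ.* d) ℚ.* (a ℚ.* c ℚ.+ b ℚ.* d)))
    (solve 4 (λ a b c d →
      (a :* c :+ b :* d) :* (a :* c :+ b :* d) :+ (a :* d :- b :* c) :* (a :* d :- b :* c)
      := (a :* a :+ b :* b) :* (c :* c :+ d :* d)) refl a b c d)
    (ℚ.+-monoʳ-≤ ((a ℚ.* c ℚ.+ b ℚ.* d) ℚ.* (a ℚ.* c ℚ.+ b ℚ.* d))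
      (²-nonNegℚ (a ℚ.* d ℚ.- b ℚ.* c)))

norm-triangle : ∀ a b c d → norm (a + c) (b + d) ≲ norm a b + norm c d
norm-triangle a b c d = ²-cancel-≲ {norm (a + c) (b + d)} {norm a b + norm c d} 0≲p+q (begin
  norm (a + c) (b + d) * norm (a + c) (b + d)
    ≈⟨ norm-square (a + c) (b + d) ⟩
  (a + c) * (a + c) + (b + d) * (b + d)
    ≈⟨ pointwise-≃ {(a + c) * (a + c) + (b + d) * (b + d)}
                   {((a * a + b * b) + (c * c + d * d)) + ((a * c + b * d) + (a * c + b * d))}
         (λ n → solve 4 (λ a b c d →
         (a :+ c) :* (a :+ c) :+ (b :+ d) :* (b :+ d)
         := ((a :* a :+ b :* b) :+ (c :* c :+ d :* d)) :+ ((a :* c :+ b :* d) :+ (a :* c :+ b :* d)))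
         refl (seq a n) (seq b n) (seq c n) (seq d n)) ⟩
  ((a * a + b * b) + (c * c + d * d)) + ((a * c + b * d) + (a * c + b * d))
    ≤⟨ +-mono-≲ {(a * a + b * b) + (c * c + d * d)} {norm a b * norm a b + norm c d * norm c d}
                {(a * c + b * d) + (a * c + b * d)} {norm a b * norm c d + norm a b * norm c d}
         (+-mono-≲ {a * a + b * b} {norm a b * norm a b} {c * c + d * d} {norm c d * norm c d}
           (≃⇒≳ (norm-square a b)) (≃⇒≳ (norm-square c d)))
         (+-mono-≲ {a * c + b * d} {norm a b * norm c d} {a * c + b * d} {norm a b * norm c d}
           (cauchy-schwarz a b c d) (cauchy-schwarz a b c d)) ⟩
  (norm a b * norm a b + norm c d * norm c d) + (norm a b * norm c d + norm a b * norm c d)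
    ≈⟨ binomial (norm a b) (norm c d) ⟩
  (norm a b + norm c d) * (norm a b + norm c d) ∎)
  where
  open ℝ-Reasoning
  open ℚ-Solver.+-*-Solver
  0≲p+q : 0ℝ ≲ norm a b + norm c d
  0≲p+q = begin
    0ℝ           ≈⟨ pointwise-≃ {0ℝ + 0ℝ} {0ℝ} (λ n → ℚ.+-identityʳ 0ℚ) ⟨
    0ℝ + 0ℝ      ≤⟨ +-mono-≲ {0ℝ} {norm a b} {0ℝ} {norm c d} (norm-nonNeg a b) (norm-nonNeg c d) ⟩
    norm a b + norm c d        ∎
  binomial : ∀ p q → (p * p + q * q) + (p * q + p * q) ≃ (p + q) * (p + q)
  binomial p q = pointwise-≃ λ n →
    solve 2 (λ p q → (p :* p :+ q :* q) :+ (p :* q :+ p :* q) := (p :+ q) :* (p :+ q)) refl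
      (seq p n) (seq q n)

-- Both sides have the same square by distributivity; t ≥ 0 makes the right side nonnegative, so the
-- squares can be cancelled.
norm-scale : ∀ {t} → 0ℝ ≲ t → ∀ a b → norm (t * a) (t * b) ≃ t * norm a b
norm-scale {t} 0≲t a b = ²-cancel-≃ {norm (t * a) (t * b)} {t * norm a b}
  (norm-nonNeg (t * a) (t * b)) (*-nonNeg {t} {norm a b} 0≲t (norm-nonNeg a b)) (begin-equality
    norm (t * a) (t * b) * norm (t * a) (t * b)
      ≈⟨ norm-square (t * a) (t * b) ⟩
    (t * a) * (t * a) + (t * b) * (t * b)
      ≈⟨ pointwise-≃ {(t * a) * (t * a) + (t * b) * (t * b)} {(t * t) * (a * a + b * b)}
         (λ n → solve 3 (λ t a b →
           (t :* a) :* (t :* a) :+ (t :* b) :* (t :* b) := (t :* t) :* (a :* a :+ b :* b))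
           refl (seq t n) (seq a n) (seq b n)) ⟩
    (t * t) * (a * a + b * b)
      ≈⟨ *-cong {t * t} {t * t} {norm a b * norm a b} {a * a + b * b} ≃-refl (norm-square a b) ⟨
    (t * t) * (norm a b * norm a b)
      ≈⟨ ²-distrib-* t (norm a b) ⟨
    (t * norm a b) * (t * norm a b) ∎)
  where
  open ℝ-Reasoning
  open ℚ-Solver.+-*-Solver

norm-zero : ∀ {a b} → norm a b ≲ 0ℝ → (a ≃ 0ℝ) × (b ≃ 0ℝ)
norm-zero {a} {b} norm≲0 = square-zero a a²≲normSq , square-zero b b²≲normSq
  where
  open ℝ-Reasoning
  p≤p+q² : ∀ p q → p ℚ.≤ p ℚ.+ q ℚ.* q
  p≤p+q² p q = subst (ℚ._≤ p ℚ.+ q ℚ.* q) (ℚ.+-identityʳ p) (ℚ.+-monoʳ-≤ p (²-nonNegℚ q))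
  a²≲normSq : a * a ≲ a * a + b * b
  a²≲normSq = pointwise-≲ λ n → p≤p+q² (seq (a * a) n) (seq b n)
  b²≲normSq : b * b ≲ a * a + b * b
  b²≲normSq = pointwise-≲ λ n → subst (seq (b * b) n ℚ.≤_) (ℚ.+-comm (seq (b * b) n) (seq (a * a) n))
    (p≤p+q² (seq (b * b) n) (seq a n))
  norm≃0 : norm a b ≃ 0ℝ
  norm≃0 = ≲-antisym norm≲0 (norm-nonNeg a b)
  square-zero : ∀ c → c * c ≲ (a * a + b * b) → c ≃ 0ℝ
  square-zero c c²≲normSq = ≲-antisym c≲0 (0≲-⇒≲ {0ℝ} {c} (begin
    0ℝ              ≤⟨ ≲⇒0≲- { - c} {0ℝ} -c≲0 ⟩
    0ℝ - (- c)      ≈⟨ pointwise-≃ {0ℝ - (- c)} {c - 0ℝ} (λ n →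
                         solve 1 (λ c → con 0ℚ :- (:- c) := c :- con 0ℚ) refl (seq c n)) ⟩
    c - 0ℝ          ∎))
    where
    open ℚ-Solver.+-*-Solver
    -- Zero is kept as a square so that `²-cancel-≲` applies. It bounds c only from above, hence its
    -- second use, on - c.
    c²≲0 : c * c ≲ 0ℝ * 0ℝ
    c²≲0 = begin
      c * c                      ≤⟨ c²≲normSq ⟩
      (a * a + b * b)                 ≈⟨ norm-square a b ⟨
      norm a b * norm a b        ≈⟨ *-cong {norm a b} {0ℝ} {norm a b} {0ℝ} norm≃0 norm≃0 ⟩
      0ℝ * 0ℝ                    ∎
    c≲0 : c ≲ 0ℝ
    c≲0 = ²-cancel-≲ {c} {0ℝ} (≃⇒≲ ≃-refl) c²≲0
    -c≲0 : - c ≲ 0ℝ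
    -c≲0 = ²-cancel-≲ { - c} {0ℝ} (≃⇒≲ ≃-refl) (begin
      (- c) * (- c)    ≈⟨ pointwise-≃ {(- c) * (- c)} {c * c} (λ n →
                            solve 1 (λ c → :- c :* :- c := c :* c) refl (seq c n)) ⟩
      c * c            ≤⟨ c²≲0 ⟩
      0ℝ * 0ℝ          ∎)

-- Points up to equality, and the metric laws of the plane

infix 4 _≃ₚ_

record _≃ₚ_ (X Y : Point) : Set where
  constructor _,_
  field
    abscissa : proj₁ X ≃ proj₁ Y
    ordinate : proj₂ X ≃ proj₂ Y

≃ₚ⇒≈ₚ : ∀ {X Y} → X ≃ₚ Y → X ≈ₚ Y
≃ₚ⇒≈ₚ (x₁≃y₁ , x₂≃y₂) = ≃⇒≈ x₁≃y₁ , ≃⇒≈ x₂≃y₂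

≃ₚ-refl : ∀ {X} → X ≃ₚ X
≃ₚ-refl = ≃-refl , ≃-refl

≃ₚ-sym : ∀ {X Y} → X ≃ₚ Y → Y ≃ₚ X
≃ₚ-sym (x₁≃y₁ , x₂≃y₂) = ≃-sym x₁≃y₁ , ≃-sym x₂≃y₂

sub-cong : ∀ {x y u v} → x ≃ y → u ≃ v → x - u ≃ y - v
sub-cong {x} {y} {u} {v} x≃y u≃v = +-cong {x} {y} { - u} { - v} x≃y (neg-cong {u} {v} u≃v)

dist-cong : ∀ {X X′ Y Y′} → X ≃ₚ X′ → Y ≃ₚ Y′ → dist X Y ≃ dist X′ Y′
dist-cong {x₁ , x₂} {x₁′ , x₂′} {y₁ , y₂} {y₁′ , y₂′} (x₁≃ , x₂≃) (y₁≃ , y₂≃) = begin-equality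
  dist (x₁ , x₂) (y₁ , y₂)            ≈⟨ dist≃norm x₁ x₂ y₁ y₂ ⟩
  norm (x₁ - y₁) (x₂ - y₂)            ≈⟨ norm-cong
                                           (sub-cong {x₁} {x₁′} {y₁} {y₁′} x₁≃ y₁≃)
                                           (sub-cong {x₂} {x₂′} {y₂} {y₂′} x₂≃ y₂≃) ⟩
  norm (x₁′ - y₁′) (x₂′ - y₂′)        ≈⟨ dist≃norm x₁′ x₂′ y₁′ y₂′ ⟨
  dist (x₁′ , x₂′) (y₁′ , y₂′)        ∎
  where open ℝ-Reasoning

dist-sym : ∀ X Y → dist X Y ≃ dist Y X
dist-sym (x₁ , x₂) (y₁ , y₂) = begin-equality
  dist (x₁ , x₂) (y₁ , y₂)            ≈⟨ dist≃norm x₁ x₂ y₁ y₂ ⟩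
  norm (x₁ - y₁) (x₂ - y₂)            ≈⟨ norm-cong (flip x₁ y₁) (flip x₂ y₂) ⟩
  norm (- (y₁ - x₁)) (- (y₂ - x₂))    ≈⟨ norm-neg (y₁ - x₁) (y₂ - x₂) ⟩
  norm (y₁ - x₁) (y₂ - x₂)            ≈⟨ dist≃norm y₁ y₂ x₁ x₂ ⟨
  dist (y₁ , y₂) (x₁ , x₂)            ∎
  where
  open ℝ-Reasoning
  flip : ∀ x y → x - y ≃ - (y - x)
  flip x y = pointwise-≃ λ n → sym (Identities.neg-diff (seq y n) (seq x n))

dist-triangle : ∀ X Y Z → dist X Z ≲ dist X Y + dist Y Z
dist-triangle (x₁ , x₂) (y₁ , y₂) (z₁ , z₂) = begin
  dist (x₁ , x₂) (z₁ , z₂)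
    ≈⟨ dist≃norm x₁ x₂ z₁ z₂ ⟩
  norm (x₁ - z₁) (x₂ - z₂)
    ≈⟨ norm-cong (telescope x₁ y₁ z₁) (telescope x₂ y₂ z₂) ⟩
  norm ((x₁ - y₁) + (y₁ - z₁)) ((x₂ - y₂) + (y₂ - z₂))
    ≤⟨ norm-triangle (x₁ - y₁) (x₂ - y₂) (y₁ - z₁) (y₂ - z₂) ⟩
  norm (x₁ - y₁) (x₂ - y₂) + norm (y₁ - z₁) (y₂ - z₂)
    ≈⟨ +-cong {dist (x₁ , x₂) (y₁ , y₂)} {norm (x₁ - y₁) (x₂ - y₂)}
              {dist (y₁ , y₂) (z₁ , z₂)} {norm (y₁ - z₁) (y₂ - z₂)}
         (dist≃norm x₁ x₂ y₁ y₂) (dist≃norm y₁ y₂ z₁ z₂) ⟨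
  dist (x₁ , x₂) (y₁ , y₂) + dist (y₁ , y₂) (z₁ , z₂) ∎
  where
  open ℝ-Reasoning
  open ℚ-Solver.+-*-Solver
  telescope : ∀ x y z → x - z ≃ (x - y) + (y - z)
  telescope x y z = pointwise-≃ λ n →
    solve 3 (λ x y z → x :- z := (x :- y) :+ (y :- z)) refl (seq x n) (seq y n) (seq z n)

dist-nonNeg : ∀ X Y → 0ℝ ≲ dist X Y
dist-nonNeg (x₁ , x₂) (y₁ , y₂) = begin
  0ℝ                          ≤⟨ norm-nonNeg (x₁ - y₁) (x₂ - y₂) ⟩
  norm (x₁ - y₁) (x₂ - y₂)    ≈⟨ dist≃norm x₁ x₂ y₁ y₂ ⟨
  dist (x₁ , x₂) (y₁ , y₂)    ∎
  where open ℝ-Reasoning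

dist-refl : ∀ X → dist X X ≃ 0ℝ
dist-refl (x₁ , x₂) = begin-equality
  dist (x₁ , x₂) (x₁ , x₂)        ≈⟨ dist≃norm x₁ x₂ x₁ x₂ ⟩
  norm (x₁ - x₁) (x₂ - x₂)        ≈⟨ norm-cong (self x₁) (self x₂) ⟩
  -- The zero vector is written as 0 times a vector, so that homogeneity with t = 0 evaluates its
  -- norm.
  norm (0ℝ * x₁) (0ℝ * x₂)        ≈⟨ norm-scale (≃⇒≲ ≃-refl) x₁ x₂ ⟩
  0ℝ * norm x₁ x₂                 ≈⟨ pointwise-≃ {0ℝ * norm x₁ x₂} {0ℝ} (λ n → ℚ.*-zeroˡ (seq (norm x₁ x₂) n)) ⟩
  0ℝ                              ∎
  where
  open ℝ-Reasoning
  self : ∀ x → x - x ≃ 0ℝ * x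
  self x = pointwise-≃ λ n → trans (ℚ.+-inverseʳ (seq x n)) (sym (ℚ.*-zeroˡ (seq x n)))

dist-zero : ∀ {X Y} → dist X Y ≲ 0ℝ → X ≃ₚ Y
dist-zero {x₁ , x₂} {y₁ , y₂} dist≲0 =
  let x₁-y₁≃0 , x₂-y₂≃0 = norm-zero {x₁ - y₁} {x₂ - y₂} norm≲0
  in difference-zero x₁ y₁ x₁-y₁≃0 , difference-zero x₂ y₂ x₂-y₂≃0
  where
  open ℝ-Reasoning
  norm≲0 : norm (x₁ - y₁) (x₂ - y₂) ≲ 0ℝ
  norm≲0 = subst (_≲ 0ℝ) (dist≡norm x₁ x₂ y₁ y₂) dist≲0
  difference-zero : ∀ x y → x - y ≃ 0ℝ → x ≃ y
  difference-zero x y x-y≃0 = begin-equality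
    x              ≈⟨ pointwise-≃ {x} {y + (x - y)} (λ n → Identities.split-diff (seq x n) (seq y n)) ⟩
    y + (x - y)    ≈⟨ +-cong {y} {y} {x - y} {0ℝ} ≃-refl x-y≃0 ⟩
    y + 0ℝ         ≈⟨ pointwise-≃ {y + 0ℝ} {y} (λ n → ℚ.+-identityʳ (seq y n)) ⟩
    y              ∎

-- With X = (1 - t)A + tB one has A - X = t(A - B) and B - X = (1 - t)(B - A). Since 0 ≤ t ≤ 1, both
-- factors leave the norm, and they add up to 1.
dist-segment : ∀ {X} A B → X ∈[ A , B ] → dist A X + dist B X ≃ dist A B
dist-segment {x₁ , x₂} (a₁ , a₂) (b₁ , b₂) (t , 0≤t , t≤1 , x₁≈ , x₂≈) = begin-equality
  dist (a₁ , a₂) (x₁ , x₂) + dist (b₁ , b₂) (x₁ , x₂)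
    ≈⟨ +-cong {dist (a₁ , a₂) (x₁ , x₂)} {norm (a₁ - x₁) (a₂ - x₂)}
              {dist (b₁ , b₂) (x₁ , x₂)} {norm (b₁ - x₁) (b₂ - x₂)}
         (dist≃norm a₁ a₂ x₁ x₂) (dist≃norm b₁ b₂ x₁ x₂) ⟩
  norm (a₁ - x₁) (a₂ - x₂) + norm (b₁ - x₁) (b₂ - x₂)
    ≈⟨ +-cong {norm (a₁ - x₁) (a₂ - x₂)} {norm (t * (a₁ - b₁)) (t * (a₂ - b₂))}
              {norm (b₁ - x₁) (b₂ - x₂)} {norm ((1ℝ - t) * - (a₁ - b₁)) ((1ℝ - t) * - (a₂ - b₂))}
         (norm-cong (from-a a₁ b₁ x₁ (≈⇒≃ x₁≈)) (from-a a₂ b₂ x₂ (≈⇒≃ x₂≈)))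
         (norm-cong (from-b a₁ b₁ x₁ (≈⇒≃ x₁≈)) (from-b a₂ b₂ x₂ (≈⇒≃ x₂≈))) ⟩
  norm (t * (a₁ - b₁)) (t * (a₂ - b₂)) + norm ((1ℝ - t) * - (a₁ - b₁)) ((1ℝ - t) * - (a₂ - b₂))
    ≈⟨ +-cong {norm (t * (a₁ - b₁)) (t * (a₂ - b₂))} {t * norm (a₁ - b₁) (a₂ - b₂)}
              {norm ((1ℝ - t) * - (a₁ - b₁)) ((1ℝ - t) * - (a₂ - b₂))}
              {(1ℝ - t) * norm (- (a₁ - b₁)) (- (a₂ - b₂))}
         (norm-scale {t} (≤⇒≲ 0≤t) (a₁ - b₁) (a₂ - b₂))
         (norm-scale {1ℝ - t} (≲⇒0≲- {t} {1ℝ} (≤⇒≲ t≤1)) (- (a₁ - b₁)) (- (a₂ - b₂))) ⟩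
  t * norm (a₁ - b₁) (a₂ - b₂) + (1ℝ - t) * norm (- (a₁ - b₁)) (- (a₂ - b₂))
    ≈⟨ +-cong {t * norm (a₁ - b₁) (a₂ - b₂)} {t * norm (a₁ - b₁) (a₂ - b₂)}
              {(1ℝ - t) * norm (- (a₁ - b₁)) (- (a₂ - b₂))} {(1ℝ - t) * norm (a₁ - b₁) (a₂ - b₂)} ≃-refl
         (*-cong {1ℝ - t} {1ℝ - t} {norm (- (a₁ - b₁)) (- (a₂ - b₂))} {norm (a₁ - b₁) (a₂ - b₂)} ≃-refl
           (norm-neg (a₁ - b₁) (a₂ - b₂))) ⟩
  t * norm (a₁ - b₁) (a₂ - b₂) + (1ℝ - t) * norm (a₁ - b₁) (a₂ - b₂)
    ≈⟨ convex (norm (a₁ - b₁) (a₂ - b₂)) ⟩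
  norm (a₁ - b₁) (a₂ - b₂)
    ≈⟨ dist≃norm a₁ a₂ b₁ b₂ ⟨
  dist (a₁ , a₂) (b₁ , b₂) ∎
  where
  open ℝ-Reasoning
  open ℚ-Solver.+-*-Solver
  convex : ∀ r → t * r + (1ℝ - t) * r ≃ r
  convex r = pointwise-≃ λ n →
    solve 2 (λ t r → t :* r :+ (con 1ℚ :- t) :* r := r) refl (seq t n) (seq r n)
  from-a : ∀ a b x → x ≃ (1ℝ - t) * a + t * b → a - x ≃ t * (a - b)
  from-a a b x x≃ = begin-equality
    a - x                                ≈⟨ sub-cong {a} {a} {x} {(1ℝ - t) * a + t * b} ≃-refl x≃ ⟩
    a - ((1ℝ - t) * a + t * b)           ≈⟨ pointwise-≃ {a - ((1ℝ - t) * a + t * b)} {t * (a - b)}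
                                              (λ n → solve 3 (λ t a b →
                                              a :- ((con 1ℚ :- t) :* a :+ t :* b) := t :* (a :- b))
                                              refl (seq t n) (seq a n) (seq b n)) ⟩
    t * (a - b)                          ∎
  from-b : ∀ a b x → x ≃ (1ℝ - t) * a + t * b → b - x ≃ (1ℝ - t) * - (a - b)
  from-b a b x x≃ = begin-equality
    b - x                                ≈⟨ sub-cong {b} {b} {x} {(1ℝ - t) * a + t * b} ≃-refl x≃ ⟩
    b - ((1ℝ - t) * a + t * b)           ≈⟨ pointwise-≃ {b - ((1ℝ - t) * a + t * b)} {(1ℝ - t) * - (a - b)}
                                              (λ n → solve 3 (λ t a b →
                                              b :- ((con 1ℚ :- t) :* a :+ t :* b) := (con 1ℚ :- t) :* :- (a :- b))
                                              refl (seq t n) (seq a n) (seq b n)) ⟩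
    (1ℝ - t) * - (a - b)                 ∎

-- Sums over the edges of a graph on Fin n

module _ {n : ℕ} where

  -- The single undirected edge between `p` and `q`; both orientations are included to keep
  -- adjacency symmetric.
  Joins : (p q : Fin n) → Rel (Fin n) 0ℓ
  Joins p q u v = (u ≡ p × v ≡ q) ⊎ (u ≡ q × v ≡ p)

  joins? : ∀ p q → Decidable (Joins p q)
  joins? p q u v = (u Fin.≟ p ×-dec v Fin.≟ q) ⊎-dec (u Fin.≟ q ×-dec v Fin.≟ p)

  joins-sym : ∀ p q → Symmetric (Joins p q)
  joins-sym p q (inj₁ (u≡p , v≡q)) = inj₂ (v≡q , u≡p)
  joins-sym p q (inj₂ (u≡q , v≡p)) = inj₁ (v≡p , u≡q)

  joins-swap : ∀ p q → Joins p q ⇒ Joins q p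
  joins-swap p q (inj₁ (u≡p , v≡q)) = inj₂ (u≡p , v≡q)
  joins-swap p q (inj₂ (u≡q , v≡p)) = inj₁ (u≡q , v≡p)

module EdgeSums (M : CommutativeMonoid 0ℓ 0ℓ) where
  open CommutativeMonoid M
    renaming (_≈_ to _≋_; refl to ≋-refl; sym to ≋-sym; trans to ≋-trans)
  open Sum M using (sum; sum-cong-≋; sum-remove)
  open SetoidReasoning setoid

  sum-update : ∀ {n} (f g : Vector Carrier n) i {x} →
               f i ≋ x ∙ g i → (∀ j → j ≢ i → f j ≋ g j) → sum f ≋ x ∙ sum g
  sum-update {suc n} f g i {x} fᵢ≈ f≈g = begin
    sum f                              ≈⟨ sum-remove {i = i} f ⟩
    f i ∙ sum (removeAt f i)           ≈⟨ ∙-cong fᵢ≈ (sum-cong-≋ λ j → f≈g (punchIn i j) (Fin.punchInᵢ≢i i j)) ⟩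
    (x ∙ g i) ∙ sum (removeAt g i)     ≈⟨ assoc x (g i) (sum (removeAt g i)) ⟩
    x ∙ (g i ∙ sum (removeAt g i))     ≈⟨ ∙-congˡ (sum-remove {i = i} g) ⟨
    x ∙ sum g                          ∎

  if-cong : ∀ {A B : Set} (A? : Dec A) (B? : Dec B) → (A → B) → (B → A) → ∀ {x y} → (A → x ≋ y) →
            (if does A? then x else ε) ≋ (if does B? then y else ε)
  if-cong (yes a) (yes _) _   _   x≈y = x≈y a
  if-cong (no _)  (no _)  _   _   _   = ≋-refl
  if-cong (yes a) (no ¬b) A⇒B _   _   = contradiction (A⇒B a) ¬b
  if-cong (no ¬a) (yes b) _   B⇒A _   = contradiction (B⇒A b) ¬a

  module _ {n : ℕ} where

    entry : {E : Rel (Fin n) 0ℓ} → Decidable E → (Fin n → Fin n → Carrier) → Fin n → Fin n → Carrier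
    entry E? w u v = if does (u Fin.<? v ×-dec E? u v) then w u v else ε

    edgeSum : {E : Rel (Fin n) 0ℓ} → Decidable E → (Fin n → Fin n → Carrier) → Carrier
    edgeSum E? w = sum λ u → sum λ v → entry E? w u v

    module _ {E F : Rel (Fin n) 0ℓ} (E? : Decidable E) (F? : Decidable F) where

      edgeSum-cong : E ⇒ F → F ⇒ E → ∀ {w w′} → (∀ {u v} → E u v → w u v ≋ w′ u v) →
                     edgeSum E? w ≋ edgeSum F? w′
      edgeSum-cong E⇒F F⇒E w≈w′ = sum-cong-≋ λ u → sum-cong-≋ λ v →
        if-cong (u Fin.<? v ×-dec E? u v) (u Fin.<? v ×-dec F? u v)
          (λ (u<v , Euv) → u<v , E⇒F Euv) (λ (u<v , Fuv) → u<v , F⇒E Fuv) (λ (_ , Euv) → w≈w′ Euv)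

    module _ {F : Rel (Fin n) 0ℓ} (F? : Decidable F) (w : Fin n → Fin n → Carrier) where

      private
        _+edge_,_ : ∀ (F? : Decidable F) p q → Decidable (F ∪ Joins p q)
        F? +edge p , q = Union.decidable F? (joins? p q)

      -- Exactly one summand changes, column `q` of row `p`: the transposed pair fails the test u <
      -- v. That `F` does not yet contain the edge makes the old summand `ε`, so the weight is added
      -- and not counted already.
      edgeSum-insert-< : ∀ p q → p Fin.< q → ¬ F p q →
                         edgeSum (F? +edge p , q) w ≋ w p q ∙ edgeSum F? w
      edgeSum-insert-< p q p<q ¬Fpq = sum-update _ _ p
        (sum-update _ _ q (begin
            entry (F? +edge p , q) w p q
              ≡⟨ cong (if_then w p q else ε)
                   (dec-true (p Fin.<? q ×-dec (F? +edge p , q) p q) (p<q , inj₂ (inj₁ (refl , refl)))) ⟩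
            w p q
              ≈⟨ identityʳ (w p q) ⟨
            w p q ∙ ε
              ≡⟨ cong (λ b → w p q ∙ (if b then w p q else ε))
                   (dec-false (p Fin.<? q ×-dec F? p q) (¬Fpq ∘ proj₂)) ⟨
            w p q ∙ entry F? w p q ∎)
          λ v v≢q → other p v (v≢q ∘ proj₂))
        λ u u≢p → sum-cong-≋ λ v → other u v (u≢p ∘ proj₁)
        where
        other : ∀ u v → ¬ (u ≡ p × v ≡ q) → entry (F? +edge p , q) w u v ≋ entry F? w u v
        other u v ≢pq = if-cong (u Fin.<? v ×-dec (F? +edge p , q) u v) (u Fin.<? v ×-dec F? u v)
          (λ { (u<v , inj₁ Fuv)                  → u<v , Fuv
             ; (u<v , inj₂ (inj₁ ≡pq))           → ⊥-elim (≢pq ≡pq)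
             ; (u<v , inj₂ (inj₂ (refl , refl))) → ⊥-elim (Fin.<-asym p<q u<v) })
          (λ (u<v , Fuv) → u<v , inj₁ Fuv)
          (λ _ → ≋-refl)

      edgeSum-insert : Symmetric F → (∀ u v → w u v ≋ w v u) → ∀ {p q} → p ≢ q → ¬ F p q →
                       edgeSum (F? +edge p , q) w ≋ w p q ∙ edgeSum F? w
      edgeSum-insert F-sym w-sym {p} {q} p≢q ¬Fpq with Fin.<-cmp p q
      ... | tri< p<q _ _ = edgeSum-insert-< p q p<q ¬Fpq
      ... | tri≈ _ p≡q _ = contradiction p≡q p≢q
      ... | tri> _ _ q<p = begin
        edgeSum (F? +edge p , q) w    ≈⟨ edgeSum-cong (F? +edge p , q) (F? +edge q , p)
                                           (λ { (inj₁ Fuv) → inj₁ Fuv ; (inj₂ J) → inj₂ (joins-swap p q J) })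
                                           (λ { (inj₁ Fuv) → inj₁ Fuv ; (inj₂ J) → inj₂ (joins-swap q p J) })
                                           (λ _ → ≋-refl) ⟩
        edgeSum (F? +edge q , p) w    ≈⟨ edgeSum-insert-< q p q<p (¬Fpq ∘ F-sym) ⟩
        w q p ∙ edgeSum F? w          ≈⟨ ∙-congʳ (w-sym q p) ⟩
        w p q ∙ edgeSum F? w          ∎

-- Topologies

unique-triple≰pair : ∀ {A : Set} {xs : List A} {a b : A} → Unique xs → length xs ≡ 3 →
                     ¬ (∀ {x} → x ∈ xs → x ≡ a ⊎ x ≡ b)
unique-triple≰pair {xs = x ∷ y ∷ z ∷ []} ((x≢y ∷ x≢z ∷ []) ∷ (y≢z ∷ []) ∷ [] ∷ []) refl ⊆ab
  with ⊆ab (here refl) | ⊆ab (there (here refl)) | ⊆ab (there (there (here refl)))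
... | inj₁ refl | inj₁ refl | _         = x≢y refl
... | inj₁ refl | inj₂ refl | inj₁ refl = x≢z refl
... | inj₁ refl | inj₂ refl | inj₂ refl = y≢z refl
... | inj₂ refl | inj₂ refl | _         = x≢y refl
... | inj₂ refl | inj₁ refl | inj₂ refl = x≢z refl
... | inj₂ refl | inj₁ refl | inj₁ refl = y≢z refl

module _ {N k : ℕ} (T : SteinerTopology N k) where
  open SteinerTopology T

  -- `NeighboursAre` alone would permit repetitions. But the list counted by the degree has three
  -- entries and no duplicates, and two equal names would confine it to two vertices.
  neighbours-distinct : ∀ S {a b c} → NeighboursAre T (steiner N S) a b c → a ≢ b × a ≢ c × b ≢ c
  neighbours-distinct S {a} {b} {c} nbrs =
      (λ { refl → not-two λ { (inj₁ u≡a) → inj₁ u≡a ; (inj₂ u≡b⊎u≡c) → u≡b⊎u≡c } })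
    , (λ { refl → not-two λ { (inj₁ u≡a)        → inj₁ u≡a
                            ; (inj₂ (inj₁ u≡b)) → inj₂ u≡b
                            ; (inj₂ (inj₂ u≡a)) → inj₁ u≡a } })
    , (λ { refl → not-two λ { (inj₁ u≡a)        → inj₁ u≡a
                            ; (inj₂ (inj₁ u≡b)) → inj₂ u≡b
                            ; (inj₂ (inj₂ u≡b)) → inj₂ u≡b } })
    where
    not-two : ∀ {p q} → ¬ (∀ {u} → u ≡ a ⊎ u ≡ b ⊎ u ≡ c → u ≡ p ⊎ u ≡ q)
    not-two abc⊆pq = unique-triple≰pair
      (filter⁺ (adj? (steiner N S)) (allFin⁺ (N ℕ.+ k))) (steiner-degree S)
      (λ {u} u∈ → abc⊆pq (Equivalence.to (nbrs u) (proj₂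
        (∈-filter⁻ (adj? (steiner N S)) {xs = allFin (N ℕ.+ k)} u∈))))

  -- The part of the tree that neither a move of the two Steiner points nor a reorganization around
  -- them can affect.
  Away : (s s′ : Fin (N ℕ.+ k)) → Rel (Fin (N ℕ.+ k)) 0ℓ
  Away s s′ u v = Adj u v × (u ≢ s × u ≢ s′) × (v ≢ s × v ≢ s′)

  away? : ∀ s s′ → Decidable (Away s s′)
  away? s s′ u v = adj? u v ×-dec (¬? (u Fin.≟ s) ×-dec ¬? (u Fin.≟ s′))
                            ×-dec (¬? (v Fin.≟ s) ×-dec ¬? (v Fin.≟ s′))

  module _ (M : CommutativeMonoid 0ℓ 0ℓ) (S S′ : Fin k) {a b c d : Fin (N ℕ.+ k)}
    (nbrs : NeighboursAre T (steiner N S) a b (steiner N S′))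
    (nbrs′ : NeighboursAre T (steiner N S′) c d (steiner N S)) where

    open CommutativeMonoid M
      renaming (_≈_ to _≋_; refl to ≋-refl; sym to ≋-sym; trans to ≋-trans)
    open EdgeSums M

    private
      s s′ : Fin (N ℕ.+ k)
      s  = steiner N S
      s′ = steiner N S′

      adj-sa : Adj s a
      adj-sa = Equivalence.from (nbrs a) (inj₁ refl)
      adj-sb : Adj s b
      adj-sb = Equivalence.from (nbrs b) (inj₂ (inj₁ refl))
      adj-ss′ : Adj s s′
      adj-ss′ = Equivalence.from (nbrs s′) (inj₂ (inj₂ refl))
      adj-s′c : Adj s′ c
      adj-s′c = Equivalence.from (nbrs′ c) (inj₁ refl)
      adj-s′d : Adj s′ d
      adj-s′d = Equivalence.from (nbrs′ d) (inj₂ (inj₁ refl))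

      adj⇒≢ : ∀ {u v} → Adj u v → v ≢ u
      adj⇒≢ adj v≡u = irreflexive (sym v≡u) adj

      a≢b : a ≢ b
      a≢b = proj₁ (neighbours-distinct S nbrs)
      a≢s′ : a ≢ s′
      a≢s′ = proj₁ (proj₂ (neighbours-distinct S nbrs))
      b≢s′ : b ≢ s′
      b≢s′ = proj₂ (proj₂ (neighbours-distinct S nbrs))
      c≢d : c ≢ d
      c≢d = proj₁ (neighbours-distinct S′ nbrs′)
      c≢s : c ≢ s
      c≢s = proj₁ (proj₂ (neighbours-distinct S′ nbrs′))
      d≢s : d ≢ s
      d≢s = proj₂ (proj₂ (neighbours-distinct S′ nbrs′))
      s≢s′ : s ≢ s′
      s≢s′ = adj⇒≢ adj-ss′ ∘ sym

      -- The edges at s and s′ are put back one at a time, in reverse order, so that peeling them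
      -- off again yields the weights in the order a, b, c, d, ss′. Each insertion needs a proof
      -- that its edge is new, which is where the inequalities above enter.
      E₀ E₁ E₂ E₃ E₄ E₅ : Rel (Fin (N ℕ.+ k)) 0ℓ
      E₀ = Away s s′
      E₁ = E₀ ∪ Joins s s′
      E₂ = E₁ ∪ Joins d s′
      E₃ = E₂ ∪ Joins c s′
      E₄ = E₃ ∪ Joins b s
      E₅ = E₄ ∪ Joins a s

      E₀? : Decidable E₀
      E₀? = away? s s′
      E₁? : Decidable E₁
      E₁? = Union.decidable E₀? (joins? s s′)
      E₂? : Decidable E₂
      E₂? = Union.decidable E₁? (joins? d s′)
      E₃? : Decidable E₃
      E₃? = Union.decidable E₂? (joins? c s′)
      E₄? : Decidable E₄
      E₄? = Union.decidable E₃? (joins? b s)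
      E₅? : Decidable E₅
      E₅? = Union.decidable E₄? (joins? a s)

      sym₀ : Symmetric E₀
      sym₀ (adj , u≢ , v≢) = symmetric adj , v≢ , u≢
      sym₁ : Symmetric E₁
      sym₁ = Union.symmetric {L = E₀} {R = (Joins s s′)} sym₀ (joins-sym s s′)
      sym₂ : Symmetric E₂
      sym₂ = Union.symmetric {L = E₁} {R = (Joins d s′)} sym₁ (joins-sym d s′)
      sym₃ : Symmetric E₃
      sym₃ = Union.symmetric {L = E₂} {R = (Joins c s′)} sym₂ (joins-sym c s′)
      sym₄ : Symmetric E₄
      sym₄ = Union.symmetric {L = E₃} {R = (Joins b s)} sym₃ (joins-sym b s)

      ¬E₀-s : ∀ {u} → ¬ E₀ u s
      ¬E₀-s (_ , _ , s≢s , _) = s≢s refl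
      ¬E₁-s′ : ∀ {u} → u ≢ s → ¬ E₁ u s′
      ¬E₁-s′ u≢s (inj₁ (_ , _ , _ , s′≢s′))  = s′≢s′ refl
      ¬E₁-s′ u≢s (inj₂ (inj₁ (u≡s , _)))     = u≢s u≡s
      ¬E₁-s′ u≢s (inj₂ (inj₂ (_ , s′≡s)))    = s≢s′ (sym s′≡s)
      ¬E₂-cs′ : ¬ E₂ c s′
      ¬E₂-cs′ (inj₁ E₁cs′)              = ¬E₁-s′ c≢s E₁cs′
      ¬E₂-cs′ (inj₂ (inj₁ (c≡d , _)))   = c≢d c≡d
      ¬E₂-cs′ (inj₂ (inj₂ (c≡s′ , _)))  = adj⇒≢ adj-s′c c≡s′
      ¬E₃-s : ∀ {u} → u ≢ s → u ≢ s′ → ¬ E₃ u s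
      ¬E₃-s u≢s u≢s′ (inj₁ (inj₁ (inj₁ E₀us)))              = ¬E₀-s E₀us
      ¬E₃-s u≢s u≢s′ (inj₁ (inj₁ (inj₂ (inj₁ (u≡s , _)))))  = u≢s u≡s
      ¬E₃-s u≢s u≢s′ (inj₁ (inj₁ (inj₂ (inj₂ (u≡s′ , _))))) = u≢s′ u≡s′
      ¬E₃-s u≢s u≢s′ (inj₁ (inj₂ (inj₁ (_ , s≡s′))))        = s≢s′ s≡s′
      ¬E₃-s u≢s u≢s′ (inj₁ (inj₂ (inj₂ (u≡s′ , _))))        = u≢s′ u≡s′
      ¬E₃-s u≢s u≢s′ (inj₂ (inj₁ (_ , s≡s′)))               = s≢s′ s≡s′
      ¬E₃-s u≢s u≢s′ (inj₂ (inj₂ (u≡s′ , _)))               = u≢s′ u≡s′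
      ¬E₄-as : ¬ E₄ a s
      ¬E₄-as (inj₁ E₃as)              = ¬E₃-s (adj⇒≢ adj-sa) a≢s′ E₃as
      ¬E₄-as (inj₂ (inj₁ (a≡b , _)))  = a≢b a≡b
      ¬E₄-as (inj₂ (inj₂ (a≡s , _)))  = adj⇒≢ adj-sa a≡s

      s-edge : ∀ {v} → Adj s v → E₅ s v
      s-edge {v} adj with Equivalence.to (nbrs v) adj
      ... | inj₁ v≡a         = inj₂ (inj₂ (refl , v≡a))
      ... | inj₂ (inj₁ v≡b)  = inj₁ (inj₂ (inj₂ (refl , v≡b)))
      ... | inj₂ (inj₂ v≡s′) = inj₁ (inj₁ (inj₁ (inj₁ (inj₂ (inj₁ (refl , v≡s′))))))

      s′-edge : ∀ {v} → Adj s′ v → E₅ s′ v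
      s′-edge {v} adj with Equivalence.to (nbrs′ v) adj
      ... | inj₁ v≡c        = inj₁ (inj₁ (inj₂ (inj₂ (refl , v≡c))))
      ... | inj₂ (inj₁ v≡d) = inj₁ (inj₁ (inj₁ (inj₂ (inj₂ (refl , v≡d)))))
      ... | inj₂ (inj₂ v≡s) = inj₁ (inj₁ (inj₁ (inj₁ (inj₂ (inj₂ (refl , v≡s))))))

      sym₅ : Symmetric E₅
      sym₅ = Union.symmetric {L = E₄} {R = (Joins a s)} sym₄ (joins-sym a s)

      -- An edge with an end at s or s′ is one of the five because the neighbour lists are
      -- exhaustive; any other edge lies in `E₀`.
      Adj⇒E₅ : Adj ⇒ E₅
      Adj⇒E₅ {u} {v} adj with u Fin.≟ s | u Fin.≟ s′ | v Fin.≟ s | v Fin.≟ s′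
      ... | yes refl | _        | _        | _        = s-edge adj
      ... | no _     | yes refl | _        | _        = s′-edge adj
      ... | no _     | no _     | yes refl | _        = sym₅ (s-edge (symmetric adj))
      ... | no _     | no _     | no _     | yes refl = sym₅ (s′-edge (symmetric adj))
      ... | no u≢s   | no u≢s′  | no v≢s   | no v≢s′  =
        inj₁ (inj₁ (inj₁ (inj₁ (inj₁ (adj , (u≢s , u≢s′) , v≢s , v≢s′)))))

      joins⇒Adj : ∀ {p q} → Adj p q → Joins p q ⇒ Adj
      joins⇒Adj adj (inj₁ (refl , refl)) = adj
      joins⇒Adj adj (inj₂ (refl , refl)) = symmetric adj

      E₅⇒Adj : E₅ ⇒ Adj
      E₅⇒Adj (inj₁ (inj₁ (inj₁ (inj₁ (inj₁ (adj , _)))))) = adj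
      E₅⇒Adj (inj₁ (inj₁ (inj₁ (inj₁ (inj₂ J)))))         = joins⇒Adj adj-ss′ J
      E₅⇒Adj (inj₁ (inj₁ (inj₁ (inj₂ J))))                = joins⇒Adj (symmetric adj-s′d) J
      E₅⇒Adj (inj₁ (inj₁ (inj₂ J)))                       = joins⇒Adj (symmetric adj-s′c) J
      E₅⇒Adj (inj₁ (inj₂ J))                              = joins⇒Adj (symmetric adj-sb) J
      E₅⇒Adj (inj₂ J)                                     = joins⇒Adj (symmetric adj-sa) J

      regroup : ∀ {x p y q z} → x ≋ p ∙ y → y ≋ q ∙ z → x ≋ (p ∙ q) ∙ z
      regroup {x} {p} {y} {q} {z} x≈ y≈ = ≋-trans x≈ (≋-trans (∙-congˡ y≈) (≋-sym (assoc p q z)))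

    edgeSum-quartet : ∀ (w : Fin (N ℕ.+ k) → Fin (N ℕ.+ k) → Carrier) → (∀ u v → w u v ≋ w v u) →
      edgeSum adj? w ≋
        w a (steiner N S) ∙ w b (steiner N S) ∙ w c (steiner N S′) ∙ w d (steiner N S′)
        ∙ w (steiner N S) (steiner N S′) ∙ edgeSum (away? (steiner N S) (steiner N S′)) w
    edgeSum-quartet w w-sym =
      regroup (regroup (regroup (regroup
        (≋-trans (edgeSum-cong adj? E₅? Adj⇒E₅ E₅⇒Adj (λ _ → ≋-refl))
                 (edgeSum-insert E₄? w sym₄ w-sym (adj⇒≢ adj-sa) ¬E₄-as))
        (edgeSum-insert E₃? w sym₃ w-sym (adj⇒≢ adj-sb) (¬E₃-s (adj⇒≢ adj-sb) b≢s′)))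
        (edgeSum-insert E₂? w sym₂ w-sym (adj⇒≢ adj-s′c) ¬E₂-cs′))
        (edgeSum-insert E₁? w sym₁ w-sym (adj⇒≢ adj-s′d) (¬E₁-s′ d≢s)))
        (edgeSum-insert E₀? w sym₀ w-sym s≢s′ (λ (_ , (s≢s , _) , _) → s≢s refl))

-- The five edges at two adjacent Steiner points

opaque
  quartet : (A B C D S S′ : Point) → ℝ
  quartet A B C D S S′ = dist A S + dist B S + dist C S′ + dist D S′ + dist S S′

  quartet≡ : ∀ A B C D S S′ →
    quartet A B C D S S′ ≡ dist A S + dist B S + dist C S′ + dist D S′ + dist S S′
  quartet≡ A B C D S S′ = refl

quartet-cong : ∀ {A A′ B B′ C C′ D D′ S T S′ T′} →
  A ≡ A′ → B ≡ B′ → C ≡ C′ → D ≡ D′ → S ≡ T → S′ ≡ T′ →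
  quartet A B C D S S′ ≡ quartet A′ B′ C′ D′ T T′
quartet-cong refl refl refl refl refl refl = refl

quartet-grouped : ∀ A B C D S S′ →
  quartet A B C D S S′ ≃ ((dist A S + dist B S) + (dist C S′ + dist D S′)) + dist S S′
quartet-grouped A B C D S S′ = ≃-trans (≡⇒≃ (quartet≡ A B C D S S′))
  (group (dist A S) (dist B S) (dist C S′) (dist D S′) (dist S S′))
  where
  open ℚ-Solver.+-*-Solver
  group : ∀ p q r t u → p + q + r + t + u ≃ ((p + q) + (r + t)) + u
  group p q r t u = pointwise-≃ λ n → solve 5 (λ p q r t u →
    p :+ q :+ r :+ t :+ u := ((p :+ q) :+ (r :+ t)) :+ u)
    refl (seq p n) (seq q n) (seq r n) (seq t n) (seq u n)

quartet-lower-bound : ∀ A B C D S S′ →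
  (dist A B + dist C D) + dist S S′ ≲ quartet A B C D S S′
quartet-lower-bound A B C D S S′ = begin
  (dist A B + dist C D) + dist S S′
    ≤⟨ +-mono-≲ {dist A B + dist C D} {(dist A S + dist B S) + (dist C S′ + dist D S′)}
                {dist S S′} {dist S S′}
         (+-mono-≲ {dist A B} {dist A S + dist B S} {dist C D} {dist C S′ + dist D S′}
           (detour A S B) (detour C S′ D))
         (≃⇒≲ ≃-refl) ⟩
  ((dist A S + dist B S) + (dist C S′ + dist D S′)) + dist S S′
    ≈⟨ quartet-grouped A B C D S S′ ⟨
  quartet A B C D S S′ ∎
  where
  open ℝ-Reasoning
  detour : ∀ X Y Z → dist X Z ≲ dist X Y + dist Z Y
  detour X Y Z = begin
    dist X Z               ≤⟨ dist-triangle X Y Z ⟩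
    dist X Y + dist Y Z    ≈⟨ +-cong {dist X Y} {dist X Y} {dist Y Z} {dist Z Y} ≃-refl (dist-sym Y Z) ⟩
    dist X Y + dist Z Y    ∎

quartet-at-intersection : ∀ {X} A B C D → X ∈[ A , B ] → X ∈[ C , D ] →
  quartet A B C D X X ≃ dist A B + dist C D
quartet-at-intersection {X} A B C D X∈AB X∈CD = begin-equality
  quartet A B C D X X
    ≈⟨ quartet-grouped A B C D X X ⟩
  ((dist A X + dist B X) + (dist C X + dist D X)) + dist X X
    ≈⟨ +-cong {(dist A X + dist B X) + (dist C X + dist D X)} {dist A B + dist C D} {dist X X} {0ℝ}
         (+-cong {dist A X + dist B X} {dist A B} {dist C X + dist D X} {dist C D}
           (dist-segment {X} A B X∈AB) (dist-segment {X} C D X∈CD))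
         (dist-refl X) ⟩
  (dist A B + dist C D) + 0ℝ
    ≈⟨ +-identityʳ (dist A B + dist C D) ⟩
  dist A B + dist C D ∎
  where
  open ℝ-Reasoning
  +-identityʳ : ∀ x → x + 0ℝ ≃ x
  +-identityʳ x = pointwise-≃ λ n → ℚ.+-identityʳ (seq x n)

-- The quartet is squeezed between |AB| + |CD| + |SS′| and |AB| + |CD|. Cancelling the common part
-- leaves |SS′| ≤ 0, and dropping the nonnegative |SS′| gives the missing half of the equality.
quartet-collapse : ∀ {X} A B C D S S′ → X ∈[ A , B ] → X ∈[ C , D ] →
  quartet A B C D S S′ ≲ quartet A B C D X X →
  (S ≃ₚ S′) × (quartet A B C D S S′ ≃ dist A B + dist C D)
quartet-collapse {X} A B C D S S′ X∈AB X∈CD quartet≲ =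
  dist-zero {S} {S′} (+-cancelʳ-≲ {dist S S′} {0ℝ} (dist A B + dist C D) SS′≲0) , ≲-antisym upper lower
  where
  open ℝ-Reasoning
  +-comm : ∀ x y → x + y ≃ y + x
  +-comm x y = pointwise-≃ λ n → ℚ.+-comm (seq x n) (seq y n)
  +-identityˡ : ∀ x → 0ℝ + x ≃ x
  +-identityˡ x = pointwise-≃ λ n → ℚ.+-identityˡ (seq x n)
  upper : quartet A B C D S S′ ≲ dist A B + dist C D
  upper = begin
    quartet A B C D S S′    ≤⟨ quartet≲ ⟩
    quartet A B C D X X     ≈⟨ quartet-at-intersection {X} A B C D X∈AB X∈CD ⟩
    dist A B + dist C D     ∎
  SS′≲0 : dist S S′ + (dist A B + dist C D) ≲ 0ℝ + (dist A B + dist C D)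
  SS′≲0 = begin
    dist S S′ + (dist A B + dist C D)    ≈⟨ +-comm (dist S S′) (dist A B + dist C D) ⟩
    (dist A B + dist C D) + dist S S′    ≤⟨ quartet-lower-bound A B C D S S′ ⟩
    quartet A B C D S S′                 ≤⟨ upper ⟩
    dist A B + dist C D                  ≈⟨ +-identityˡ (dist A B + dist C D) ⟨
    0ℝ + (dist A B + dist C D)           ∎
  lower : dist A B + dist C D ≲ quartet A B C D S S′
  lower = begin
    dist A B + dist C D                  ≈⟨ +-identityˡ (dist A B + dist C D) ⟨
    0ℝ + (dist A B + dist C D)           ≤⟨ +-mono-≲ {0ℝ} {dist S S′} {dist A B + dist C D} {dist A B + dist C D}
                                              (dist-nonNeg S S′) (≃⇒≲ ≃-refl) ⟩
    dist S S′ + (dist A B + dist C D)    ≈⟨ +-comm (dist S S′) (dist A B + dist C D) ⟩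
    (dist A B + dist C D) + dist S S′    ≤⟨ quartet-lower-bound A B C D S S′ ⟩
    quartet A B C D S S′                 ∎

module _ {S S′ : Point} (S≃S′ : S ≃ₚ S′) where

  -- With all four outer edges ending at `S`, the sum is symmetric in `A`, `B`, `C`, `D`, so any
  -- re-pairing is a permutation of summands. The edge from `S` to `S′` is kept, as it occurs in
  -- every pairing.
  quartet-coincident : ∀ A B C D →
    quartet A B C D S S′ ≃ ((dist A S + dist B S) + (dist C S + dist D S)) + dist S S′
  quartet-coincident A B C D = ≃-trans (quartet-grouped A B C D S S′)
    (+-cong {(dist A S + dist B S) + (dist C S′ + dist D S′)} {(dist A S + dist B S) + (dist C S + dist D S)}
            {dist S S′} {dist S S′}
      (+-cong {dist A S + dist B S} {dist A S + dist B S} {dist C S′ + dist D S′} {dist C S + dist D S} ≃-refl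
        (+-cong {dist C S′} {dist C S} {dist D S′} {dist D S}
          (dist-cong {C} {C} {S′} {S} ≃ₚ-refl (≃ₚ-sym S≃S′))
          (dist-cong {D} {D} {S′} {S} ≃ₚ-refl (≃ₚ-sym S≃S′))))
      ≃-refl)

  quartet-rotate : ∀ A B C D → quartet B C A D S S′ ≃ quartet A B C D S S′
  quartet-rotate A B C D = begin-equality
    quartet B C A D S S′
      ≈⟨ quartet-coincident B C A D ⟩
    ((dist B S + dist C S) + (dist A S + dist D S)) + dist S S′
      ≈⟨ rotate (dist A S) (dist B S) (dist C S) (dist D S) (dist S S′) ⟩
    ((dist A S + dist B S) + (dist C S + dist D S)) + dist S S′
      ≈⟨ quartet-coincident A B C D ⟨
    quartet A B C D S S′ ∎
    where
    open ℝ-Reasoning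
    open ℚ-Solver.+-*-Solver
    rotate : ∀ p q r t u → ((q + r) + (p + t)) + u ≃ ((p + q) + (r + t)) + u
    rotate p q r t u = pointwise-≃ λ n → solve 5 (λ p q r t u →
      ((q :+ r) :+ (p :+ t)) :+ u := ((p :+ q) :+ (r :+ t)) :+ u)
      refl (seq p n) (seq q n) (seq r n) (seq t n) (seq u n)

  quartet-swap : ∀ A B C D → quartet A C B D S S′ ≃ quartet A B C D S S′
  quartet-swap A B C D = begin-equality
    quartet A C B D S S′
      ≈⟨ quartet-coincident A C B D ⟩
    ((dist A S + dist C S) + (dist B S + dist D S)) + dist S S′
      ≈⟨ swap (dist A S) (dist B S) (dist C S) (dist D S) (dist S S′) ⟩
    ((dist A S + dist B S) + (dist C S + dist D S)) + dist S S′
      ≈⟨ quartet-coincident A B C D ⟨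
    quartet A B C D S S′ ∎
    where
    open ℝ-Reasoning
    open ℚ-Solver.+-*-Solver
    swap : ∀ p q r t u → ((p + r) + (q + t)) + u ≃ ((p + q) + (r + t)) + u
    swap p q r t u = pointwise-≃ λ n → solve 5 (λ p q r t u →
      ((p :+ r) :+ (q :+ t)) :+ u := ((p :+ q) :+ (r :+ t)) :+ u)
      refl (seq p n) (seq q n) (seq r n) (seq t n) (seq u n)

-- Moving two Steiner points and reorganizing their neighbourhoods

-- Opaque copies of _+_ and dist: conversion checking would otherwise compare
-- the convergence proofs of whole tree lengths.
infixl 6 _⊕_

opaque
  _⊕_ : ℝ → ℝ → ℝ
  _⊕_ = _+_

  ⊕-isCommutativeMonoid : IsCommutativeMonoid _≃_ _⊕_ 0ℝ
  ⊕-isCommutativeMonoid = CommutativeMonoid.isCommutativeMonoid +-commutativeMonoid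

  ⊕-cancelʳ-≲ : ∀ {x y} z → x ⊕ z ≲ y ⊕ z → x ≲ y
  ⊕-cancelʳ-≲ {x} {y} z = +-cancelʳ-≲ {x} {y} z

  ⊕-five : ∀ p q r t u → p ⊕ q ⊕ r ⊕ t ⊕ u ≃ p + q + r + t + u
  ⊕-five p q r t u = pointwise-≃ λ _ → refl

  distance : Point → Point → ℝ
  distance = dist

  distance≡dist : ∀ X Y → distance X Y ≡ dist X Y
  distance≡dist X Y = refl

⊕-commutativeMonoid : CommutativeMonoid 0ℓ 0ℓ
⊕-commutativeMonoid = record { isCommutativeMonoid = ⊕-isCommutativeMonoid }

open CommutativeMonoid ⊕-commutativeMonoid using () renaming (∙-cong to ⊕-cong)
open EdgeSums ⊕-commutativeMonoid using (edgeSum; edgeSum-cong)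

distance-sym : ∀ X Y → distance X Y ≃ distance Y X
distance-sym X Y = subst₂ _≃_ (sym (distance≡dist X Y)) (sym (distance≡dist Y X)) (dist-sym X Y)

quartet-⊕ : ∀ A B C D S S′ →
  distance A S ⊕ distance B S ⊕ distance C S′ ⊕ distance D S′ ⊕ distance S S′ ≃ quartet A B C D S S′
quartet-⊕ A B C D S S′ = begin-equality
  distance A S ⊕ distance B S ⊕ distance C S′ ⊕ distance D S′ ⊕ distance S S′
    ≈⟨ ⊕-cong (⊕-cong (⊕-cong (⊕-cong (≃dist A S) (≃dist B S)) (≃dist C S′)) (≃dist D S′)) (≃dist S S′) ⟩
  dist A S ⊕ dist B S ⊕ dist C S′ ⊕ dist D S′ ⊕ dist S S′
    ≈⟨ ⊕-five (dist A S) (dist B S) (dist C S′) (dist D S′) (dist S S′) ⟩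
  dist A S + dist B S + dist C S′ + dist D S′ + dist S S′
    ≈⟨ ≡⇒≃ (quartet≡ A B C D S S′) ⟨
  quartet A B C D S S′ ∎
  where
  open ℝ-Reasoning
  ≃dist : ∀ X Y → distance X Y ≃ dist X Y
  ≃dist X Y = ≡⇒≃ (distance≡dist X Y)

-- Tree length as five edges plus a remainder

module _ {N k : ℕ} (P : Fin N → Point) where

  edgeLength : (Fin k → Point) → Vertex N k → Vertex N k → ℝ
  edgeLength x u v = distance (position P x u) (position P x v)

  edgeLength-sym : ∀ x u v → edgeLength x u v ≃ edgeLength x v u
  edgeLength-sym x u v = distance-sym (position P x u) (position P x v)

  opaque
    unfolding _⊕_ distance

    -- Definitional once the opaque copies unfold: both sides are the same double fold with the same
    -- test on u < v and adjacency.
    treeLength≡edgeSum : ∀ T x → treeLength T P x ≡ edgeSum (SteinerTopology.adj? T) (edgeLength x)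
    treeLength≡edgeSum T x = refl

  position-steiner : ∀ (x : Fin k → Point) S → position P x (steiner N S) ≡ x S
  position-steiner x S = cong [ P , x ]′ (Fin.splitAt-↑ʳ N k S)

  awayLength : SteinerTopology N k → (S S′ : Fin k) → (Fin k → Point) → ℝ
  awayLength T S S′ x = edgeSum (away? T (steiner N S) (steiner N S′)) (edgeLength x)

  treeLength-quartet : ∀ T {S S′ a b c d} →
    NeighboursAre T (steiner N S) a b (steiner N S′) → NeighboursAre T (steiner N S′) c d (steiner N S) →
    ∀ x → treeLength T P x ≃
      quartet (position P x a) (position P x b) (position P x c) (position P x d) (x S) (x S′)
      ⊕ awayLength T S S′ x
  treeLength-quartet T {S} {S′} {a} {b} {c} {d} nbrs nbrs′ x = begin-equality
    treeLength T P x
      ≈⟨ ≡⇒≃ (treeLength≡edgeSum T x) ⟩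
    edgeSum (SteinerTopology.adj? T) (edgeLength x)
      ≈⟨ edgeSum-quartet T ⊕-commutativeMonoid S S′ nbrs nbrs′ (edgeLength x) (edgeLength-sym x) ⟩
    edgeLength x a s ⊕ edgeLength x b s ⊕ edgeLength x c s′ ⊕ edgeLength x d s′ ⊕ edgeLength x s s′ ⊕ away
      ≈⟨ ⊕-cong (quartet-⊕ pa pb pc pd (position P x s) (position P x s′)) ≃-refl ⟩
    quartet pa pb pc pd (position P x s) (position P x s′) ⊕ away
      ≈⟨ ⊕-cong (≡⇒≃ (cong₂ (quartet pa pb pc pd) (position-steiner x S) (position-steiner x S′))) ≃-refl ⟩
    quartet pa pb pc pd (x S) (x S′) ⊕ away ∎
    where
    open ℝ-Reasoning
    s s′ : Vertex N k
    s  = steiner N S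
    s′ = steiner N S′
    pa pb pc pd : Point
    pa = position P x a
    pb = position P x b
    pc = position P x c
    pd = position P x d
    away : ℝ
    away = awayLength T S S′ x

  module _ (S S′ : Fin k) (X : Point) (x : Fin k → Point) where

    moved : Fin k → Point
    moved i = if does (i Fin.≟ S ⊎-dec i Fin.≟ S′) then X else x i

    moved-S : moved S ≡ X
    moved-S = cong (if_then X else x S) (dec-true (S Fin.≟ S ⊎-dec S Fin.≟ S′) (inj₁ refl))

    moved-S′ : moved S′ ≡ X
    moved-S′ = cong (if_then X else x S′) (dec-true (S′ Fin.≟ S ⊎-dec S′ Fin.≟ S′) (inj₂ refl))

    position-moved : ∀ {v} → v ≢ steiner N S → v ≢ steiner N S′ → position P moved v ≡ position P x v
    position-moved {v} v≢s v≢s′ with splitAt N v in split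
    ... | inj₁ _ = refl
    ... | inj₂ i = cong (if_then X else x i) (dec-false (i Fin.≟ S ⊎-dec i Fin.≟ S′) λ
      { (inj₁ refl) → v≢s  (sym (Fin.splitAt⁻¹-↑ʳ split))
      ; (inj₂ refl) → v≢s′ (sym (Fin.splitAt⁻¹-↑ʳ split)) })

    -- The weights need to agree only on the edges actually summed, and these have both ends at
    -- vertices that stay in place.
    awayLength-moved : ∀ T → awayLength T S S′ x ≃ awayLength T S S′ moved
    awayLength-moved T = edgeSum-cong s? s? (λ away → away) (λ away → away)
      λ (_ , (u≢s , u≢s′) , v≢s , v≢s′) → ≡⇒≃ (sym
        (cong₂ distance (position-moved u≢s u≢s′) (position-moved v≢s v≢s′)))
      where
      s? = away? T (steiner N S) (steiner N S′)

  module _ (T₀ T : SteinerTopology N k) {S S′ : Fin k} {a b c d a′ b′ c′ d′ : Vertex N k}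
    (nbrs : NeighboursAre T₀ (steiner N S) a b (steiner N S′))
    (nbrs′ : NeighboursAre T₀ (steiner N S′) c d (steiner N S))
    (reorganization : IsReorganization T₀ T S S′ a′ b′ c′ d′) where

    open IsReorganization reorganization

    awayLength-reorganized : ∀ x → awayLength T S S′ x ≃ awayLength T₀ S S′ x
    awayLength-reorganized x = edgeSum-cong (away? T _ _) (away? T₀ _ _)
      (λ { {u} {v} (adj , (u≢s , u≢s′) , v≢s , v≢s′) →
           Equivalence.from (unchanged u v u≢s u≢s′ v≢s v≢s′) adj , (u≢s , u≢s′) , v≢s , v≢s′ })
      (λ { {u} {v} (adj , (u≢s , u≢s′) , v≢s , v≢s′) →
           Equivalence.to (unchanged u v u≢s u≢s′ v≢s v≢s′) adj , (u≢s , u≢s′) , v≢s , v≢s′ })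
      (λ _ → ≃-refl)

    -- The placement `x` is itself a competitor for `T`, so `L` is at most the length of `T` at `x`.
    -- That length equals the one for `T₀`, since the quartets agree by assumption and the
    -- remainders by `unchanged`.
    minimalLength-reorganized : ∀ x →
      quartet (position P x a′) (position P x b′) (position P x c′) (position P x d′) (x S) (x S′) ≃
        quartet (position P x a) (position P x b) (position P x c) (position P x d) (x S) (x S′) →
      ∀ L → IsMinimalLength T P L → L ≤ treeLength T₀ P x
    minimalLength-reorganized x q′≃q L (z , z-minimal , z≈L) = ≲⇒≤ (begin
      L
        ≈⟨ ≈⇒≃ z≈L ⟨
      treeLength T P z
        ≤⟨ ≤⇒≲ (z-minimal x) ⟩
      treeLength T P x
        ≈⟨ treeLength-quartet T neighbours-S neighbours-S′ x ⟩
      q′ ⊕ awayLength T S S′ x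
        ≈⟨ ⊕-cong q′≃q (awayLength-reorganized x) ⟩
      q ⊕ awayLength T₀ S S′ x
        ≈⟨ treeLength-quartet T₀ nbrs nbrs′ x ⟨
      treeLength T₀ P x ∎)
      where
      open ℝ-Reasoning
      q q′ : ℝ
      q′ = quartet (position P x a′) (position P x b′) (position P x c′) (position P x d′) (x S) (x S′)
      q = quartet (position P x a) (position P x b) (position P x c) (position P x d) (x S) (x S′)

  -- Global minimality is tested against the placement with both Steiner points moved to `X`; the
  -- unchanged remainder cancels, leaving a comparison of the five edges alone.
  minimal⇒quartet-minimal : ∀ T {S S′ a b c d} →
    NeighboursAre T (steiner N S) a b (steiner N S′) → NeighboursAre T (steiner N S′) c d (steiner N S) →
    ∀ {x} → IsMinimalTree T P x → ∀ X →
    quartet (position P x a) (position P x b) (position P x c) (position P x d) (x S) (x S′) ≲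
      quartet (position P x a) (position P x b) (position P x c) (position P x d) X X
  minimal⇒quartet-minimal T {S} {S′} {a} {b} {c} {d} nbrs nbrs′ {x} x-minimal X =
    ⊕-cancelʳ-≲ {Q x (x S) (x S′)} {Q x X X} (awayLength T S S′ x) (begin
      Q x (x S) (x S′) ⊕ awayLength T S S′ x
        ≈⟨ treeLength-quartet T nbrs nbrs′ x ⟨
      treeLength T P x
        ≤⟨ ≤⇒≲ (x-minimal y) ⟩
      treeLength T P y
        ≈⟨ treeLength-quartet T nbrs nbrs′ y ⟩
      Q y (y S) (y S′) ⊕ awayLength T S S′ y
        ≈⟨ ⊕-cong Qy≃Qx (≃-sym (awayLength-moved S S′ X x T)) ⟩
      Q x X X ⊕ awayLength T S S′ x ∎)
    where
    open ℝ-Reasoning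
    open SteinerTopology T using (Adj; irreflexive)
    y : Fin k → Point
    y = moved S S′ X x
    Q : (Fin k → Point) → Point → Point → ℝ
    Q z = quartet (position P z a) (position P z b) (position P z c) (position P z d)
    Qy≃Qx : Q y (y S) (y S′) ≃ Q x X X
    -- The outer vertices may be Steiner points too, so they stay in place only because each differs
    -- from both `S` and `S′`: from one by irreflexivity, from the other by distinctness of
    -- neighbours.
    Qy≃Qx = ≡⇒≃ (quartet-cong
      (fixed (adj⇒≢ (Equivalence.from (nbrs a) (inj₁ refl))) (proj₁ (proj₂ (neighbours-distinct T S nbrs))))
      (fixed (adj⇒≢ (Equivalence.from (nbrs b) (inj₂ (inj₁ refl)))) (proj₂ (proj₂ (neighbours-distinct T S nbrs))))
      (fixed (proj₁ (proj₂ (neighbours-distinct T S′ nbrs′))) (adj⇒≢ (Equivalence.from (nbrs′ c) (inj₁ refl))))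
      (fixed (proj₂ (proj₂ (neighbours-distinct T S′ nbrs′))) (adj⇒≢ (Equivalence.from (nbrs′ d) (inj₂ (inj₁ refl)))))
      (moved-S S S′ X x) (moved-S′ S S′ X x))
      where
      adj⇒≢ : ∀ {u v} → Adj u v → v ≢ u
      adj⇒≢ adj v≡u = irreflexive (sym v≡u) adj
      fixed : ∀ {v} → v ≢ steiner N S → v ≢ steiner N S′ → position P y v ≡ position P x v
      fixed = position-moved S S′ X x

mainTheorem1 : ∀ (N : ℕ) (P : Fin N → Point) (T₀ : FullTopology N)
    (S S′ : Fin (N ∸ 2)) (A B C D : Vertex N (N ∸ 2)) →
    NeighboursAre T₀ (steiner N S) A B (steiner N S′) →
    NeighboursAre T₀ (steiner N S′) C D (steiner N S) →
    ∀ (T₁ T₂ : FullTopology N) →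
    IsReorganization T₀ T₁ S S′ B C A D →
    IsReorganization T₀ T₂ S S′ A C B D →
    ∀ (x : Fin (N ∸ 2) → Point) →
    IsMinimalTree T₀ P x →
    SegmentsIntersect (position P x A) (position P x B) (position P x C) (position P x D) →
    (x S ≈ₚ x S′)
    × ((∀ L₁ → IsMinimalLength T₁ P L₁ → L₁ ≤ treeLength T₀ P x)
    × (∀ L₂ → IsMinimalLength T₂ P L₂ → L₂ ≤ treeLength T₀ P x))
    × (dist (position P x A) (x S) + dist (position P x B) (x S)
    + dist (position P x C) (x S′) + dist (position P x D) (x S′)
    + dist (x S) (x S′)
    ≈ dist (position P x A) (position P x B) + dist (position P x C) (position P x D))
mainTheorem1 N P T₀ S S′ A B C D nbrs nbrs′ T₁ T₂ reorg₁ reorg₂ x x-minimal (X , X∈AB , X∈CD) =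
    ≃ₚ⇒≈ₚ (proj₁ collapse)
  , ( minimalLength-reorganized P T₀ T₁ nbrs nbrs′ reorg₁ x (quartet-rotate (proj₁ collapse) a b c d)
    , minimalLength-reorganized P T₀ T₂ nbrs nbrs′ reorg₂ x (quartet-swap (proj₁ collapse) a b c d))
  , ≃⇒≈ (≃-trans (≡⇒≃ (sym (quartet≡ a b c d (x S) (x S′)))) (proj₂ collapse))
  where
  a b c d : Point
  a = position P x A
  b = position P x B
  c = position P x C
  d = position P x D
  -- Its two halves are claims (1) and (3); the first half also feeds claim (2), because re-pairing
  -- the outer vertices preserves the quartet when `S` and `S′` coincide.
  collapse : (x S ≃ₚ x S′) × (quartet a b c d (x S) (x S′) ≃ dist a b + dist c d)
  collapse = quartet-collapse {X} a b c d (x S) (x S′) X∈AB X∈CD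
    (minimal⇒quartet-minimal P T₀ nbrs nbrs′ x-minimal X)
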